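{- Let $k\ge 2$ and $f\in\mathsf{EASY}(k)$. Then the problem of exactly computing $Z_{f;H}$, given as input a $k$-uniform hypergraph $H$, can be solved in time polynomial in the size of $H$.
   Context: A $k$-uniform hypergraph $H=(V,\mathcal F)$ consists of a finite vertex set $V$ and a set $\mathcal F$ of hyperedges, each a $k$-element subset of $V$. For a symmetric function $f$ on $\{0,1\}^k$, the partition function is $$Z_{f;H}=\sum_{\sigma:V\to\{0,1\}}\ \prod_{\{v_1,\dots,v_k\}\in\mathcal F} f(\sigma(v_1),\dots,\sigma(v_k)).$$ $\mathsf{EASY}(k)$ is the set consisting of the following seven functions of $(x_1,\dots,x_k)\in\{0,1\}^k$: the constant $0$; the constant $1$; $\mathbf 1\{x_1=\dots=x_k=0\}$; $\mathbf 1\{x_1=\dots=x_k=1\}$; $\mathbf 1\{x_1=\dots=x_k\}$; $\mathbf 1\{x_1\oplus\cdots\oplus x_k=0\}$; $\mathbf 1\{x_1\oplus\cdots\oplus x_k=1\}$. -}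

module Defs where

open import Data.Bool.Base using (Bool; true; false; _xor_; if_then_else_)
open import Data.Fin.Base using (Fin; zero; suc)
open import Data.Fin.Subset using (Subset; ∣_∣; inside; outside)
open import Data.List.Base using (List; []; _∷_; _++_; concatMap; length; replicate)
  renaming (map to mapL)
open import Data.List.Relation.Binary.Permutation.Propositional using (_↭_)
open import Data.List.Relation.Unary.Unique.Propositional using (Unique)
open import Data.Maybe.Base as Maybe using (Maybe; just; nothing)
open import Data.Nat.Base using (ℕ; zero; suc; _+_; _*_; _^_; _≤_)
open import Data.Nat.ListAction using (sum; product)
open import Data.Product.Base using (Σ; ∃-syntax; _×_; _,_; proj₁; proj₂)
open import Data.Vec.Base using (Vec; []; _∷_; lookup; toList; map; zipWith; foldr′)
  renaming (replicate to replicateV)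
open import Data.Vec.Relation.Unary.All using (All)
open import Function.Bundles using (_↔_)
open import Relation.Binary.PropositionalEquality using (_≡_; refl)
open import Relation.Nullary.Negation.Core using (¬_)

------------------------------------------------------------------------
-- Hypergraphs and partition functions

Hyperedge : ℕ → ℕ → Set
Hyperedge k n = Σ (Subset n) λ e → ∣ e ∣ ≡ k

-- The vertex set is Fin order.
record Hypergraph (k : ℕ) : Set where
  field
    order      : ℕ
    hyperedges : List (Hyperedge k order)
    distinct   : Unique (mapL proj₁ hyperedges)

-- Natural-number values suffice: all functions in EASY are {0,1}-valued.
record SymmetricFunction (k : ℕ) : Set where
  field
    fun       : Vec Bool k → ℕ
    symmetric : ∀ x y → toList x ↭ toList y → fun x ≡ fun y

members : ∀ {n} (e : Subset n) → Vec (Fin n) ∣ e ∣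
members []            = []
members (inside  ∷ e) = zero ∷ map suc (members e)
members (outside ∷ e) = map suc (members e)

-- The members of a hyperedge are listed in increasing order; by symmetry
-- of f the choice of order does not affect the partition function.
vertices : ∀ {k n} → Hyperedge k n → Vec (Fin n) k
vertices (e , refl) = members e

assignments : ∀ n → List (Vec Bool n)
assignments zero    = [] ∷ []
assignments (suc n) =
  mapL (false ∷_) (assignments n) ++ mapL (true ∷_) (assignments n)

Z : ∀ {k} → SymmetricFunction k → Hypergraph k → ℕ
Z f H = sum (mapL weight (assignments order))
  where
  open SymmetricFunction f
  open Hypergraph H
  weight : Vec Bool order → ℕ
  weight σ = product (mapL (λ e → fun (map (lookup σ) (vertices e))) hyperedges)

------------------------------------------------------------------------
-- The class EASY

IsIndicator : ∀ {k} → (Vec Bool k → ℕ) → (Vec Bool k → Set) → Set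
IsIndicator f P = ∀ x → (P x → f x ≡ 1) × (¬ P x → f x ≡ 0)

⨁ : ∀ {k} → Vec Bool k → Bool
⨁ = foldr′ _xor_ false

-- Membership is up to pointwise equality of functions.
data EASY {k : ℕ} (f : SymmetricFunction k) : Set where
  const-0   : (∀ x → SymmetricFunction.fun f x ≡ 0) → EASY f
  const-1   : (∀ x → SymmetricFunction.fun f x ≡ 1) → EASY f
  all-0     : IsIndicator (SymmetricFunction.fun f) (All (_≡ false)) → EASY f
  all-1     : IsIndicator (SymmetricFunction.fun f) (All (_≡ true)) → EASY f
  all-equal : IsIndicator (SymmetricFunction.fun f)
                (λ x → ∀ i j → lookup x i ≡ lookup x j) → EASY f
  even      : IsIndicator (SymmetricFunction.fun f) (λ x → ⨁ x ≡ false) → EASY f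
  odd       : IsIndicator (SymmetricFunction.fun f) (λ x → ⨁ x ≡ true) → EASY f

------------------------------------------------------------------------
-- Deterministic multi-tape Turing machines

data Symbol (extras : ℕ) : Set where
  blank : Symbol extras
  bit   : Bool → Symbol extras
  extra : Fin extras → Symbol extras

data Move : Set where
  left stay right : Move

-- A two-way infinite tape, blank outside the listed cells; both lists start
-- with the cell nearest to the head.
record Tape (extras : ℕ) : Set where
  constructor tape
  field
    before : List (Symbol extras)
    head   : Symbol extras
    after  : List (Symbol extras)

module _ {extras : ℕ} where

  write : Symbol extras → Tape extras → Tape extras
  write a (tape ls _ rs) = tape ls a rs

  move : Move → Tape extras → Tape extras
  move left  (tape []       a rs)       = tape [] blank (a ∷ rs)
  move left  (tape (l ∷ ls) a rs)       = tape ls l (a ∷ rs)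
  move stay  t                          = t
  move right (tape ls       a [])       = tape (a ∷ ls) blank []
  move right (tape ls       a (r ∷ rs)) = tape (a ∷ ls) r rs

  emptyTape : Tape extras
  emptyTape = tape [] blank []

  load : List Bool → Tape extras
  load []      = emptyTape
  load (b ∷ w) = tape [] (bit b) (mapL bit w)

  leadingBits : List (Symbol extras) → List Bool
  leadingBits (bit b ∷ s) = b ∷ leadingBits s
  leadingBits _           = []

  -- The maximal bit string starting at the head and extending to the right.
  unload : Tape extras → List Bool
  unload (tape _ a rs) = leadingBits (a ∷ rs)

-- Tape 0 is the input tape, tape 1 the output tape, the others are work
-- tapes.  The machine halts when δ returns nothing.
record TuringMachine : Set₁ where
  field
    State        : Set
    states       : ℕ
    finite       : State ↔ Fin states
    extras       : ℕ
    workTapes    : ℕ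

  tapes : ℕ
  tapes = 2 + workTapes

  field
    start : State
    δ     : State → Vec (Symbol extras) tapes →
            Maybe (State × Vec (Symbol extras × Move) tapes)

  Config : Set
  Config = State × Vec (Tape extras) tapes

  act : Symbol extras × Move → Tape extras → Tape extras
  act (a , m) t = move m (write a t)

  step : Config → Maybe Config
  step (q , ts) =
    Maybe.map (λ (q′ , actions) → q′ , zipWith act actions ts)
              (δ q (map Tape.head ts))

  initial : List Bool → Config
  initial w = start , load w ∷ replicateV (1 + workTapes) emptyTape

  output : Config → List Bool
  output (_ , ts) = unload (lookup ts (suc zero))

  data _HaltsIn_At_ : Config → ℕ → Config → Set where
    halt : ∀ {c} → step c ≡ nothing → c HaltsIn 0 At c
    next : ∀ {c c′ c″ n} → step c ≡ just c′ → c′ HaltsIn n At c″ →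
           c HaltsIn suc n At c″

------------------------------------------------------------------------
-- Polynomial-time computation of ℕ-valued functions

-- Binary notation, least significant bit first; the output may be padded
-- with zeros at the most significant end.
binaryValue : List Bool → ℕ
binaryValue []      = 0
binaryValue (b ∷ w) = (if b then 1 else 0) + 2 * binaryValue w

-- F a is computed exactly from the string encode a within
-- C * (1 + size a) ^ d steps, with the machine, C and d independent of a.
record PolynomialTime {A : Set} (encode : A → List Bool) (size : A → ℕ)
                      (F : A → ℕ) : Set₁ where
  field
    machine : TuringMachine
    C d     : ℕ

  open TuringMachine machine

  field
    computes : ∀ a → ∃[ n ] ∃[ c ]
      initial (encode a) HaltsIn n At c
      × binaryValue (output c) ≡ F a
      × n ≤ C * suc (size a) ^ d

module _ {k : ℕ} (H : Hypergraph k) where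
  open Hypergraph H

  -- The number of vertices in unary, terminated by a zero, followed by the
  -- rows of the incidence matrix, one row per hyperedge.
  encodeHypergraph : List Bool
  encodeHypergraph =
    replicate order true ++ false ∷ concatMap (λ e → toList (proj₁ e)) hyperedges

  -- |V| + |F|.  As k is fixed, this is polynomially related to the length of
  -- any reasonable encoding that lists all vertices.
  sizeHypergraph : ℕ
  sizeHypergraph = order + length hyperedges

module Submission where

-- Every function in EASY(k) is the indicator of the solution set of a system of
-- affine equations over the field with two elements, so Z counts the solutions
-- σ of a system with one group of equations per hyperedge.  With a coordinate 1
-- appended to σ the equations become homogeneous.  A machine keeps generators
-- of the solution space of the equations read so far, initially the unit
-- vectors.  For a new equation, the first generator violating it becomes the
-- pivot: it is deleted, and added to all later generators violating it.  The
-- last generator is the only one with final coordinate 1; if it survives next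
-- to d others, there are 2 ^ d solutions, and otherwise none.

open import Defs
import Algebra.Properties.CommutativeSemigroup as CommutativeSemigroupProperties
open import Algebra.Bundles using (CommutativeRing)
open import Data.Bool.Base using (Bool; true; false; not; _∧_; _xor_; if_then_else_)
open import Data.Bool.ListAction using (all)
open import Data.Bool.Properties
  using (∧-distribˡ-xor; ∧-zeroʳ; xor-assoc; xor-comm; xor-identityʳ; xor-identityˡ; xor-same;
         xor-∧-commutativeRing)
open import Data.Fin.Base using (Fin; zero; suc)
open import Data.Fin.Properties using (+↔⊎; 1↔⊤)
open import Data.Fin.Subset using (Subset; ∣_∣; inside; outside)
open import Data.List.Base as List using (List; []; _∷_; _++_; _ʳ++_; length)
import Data.List.Properties as Listₚ
open import Data.Maybe.Base as Maybe using (Maybe; just; nothing; fromMaybe)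
open import Data.Maybe.Relation.Unary.All as MaybeAll using (just; nothing)
open import Data.Nat.Base using (ℕ; zero; suc; _+_; _*_; _^_; _≤_; z≤n; s≤s; pred)
open import Data.Nat.GeneralisedArithmetic using (fold)
open import Data.Nat.ListAction using (sum; product)
open import Data.Nat.ListAction.Properties using (sum-++)
open import Data.Nat.Properties
open import Data.Product.Base using (∃-syntax; _×_; _,_; proj₁; proj₂)
open import Data.Sum.Base using (_⊎_; inj₁; inj₂)
open import Data.Sum.Function.Propositional using (_⊎-↔_)
open import Data.Unit.Base using (⊤; tt)
open import Data.Vec.Base as Vec using (Vec; []; _∷_; _∷ʳ_)
open import Data.Vec.Membership.Propositional.Properties using (∈-lookup)
import Data.Vec.Properties as Vecₚ
open import Data.Vec.Relation.Unary.All as VecAll using (All; []; _∷_)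
open import Function.Base using (_∘_; const)
open import Function.Bundles using (_↔_)
open import Function.Properties.Inverse using (↔-sym; ↔-trans)
open import Relation.Binary.PropositionalEquality
open import Relation.Nullary.Negation using (contradiction)

open CommutativeSemigroupProperties +-commutativeSemigroup using (interchange)
open CommutativeSemigroupProperties *-commutativeSemigroup
  using () renaming (interchange to *-interchange)
open CommutativeSemigroupProperties
  (CommutativeRing.+-commutativeSemigroup xor-∧-commutativeRing)
  using () renaming (interchange to xor-interchange)

-- Keeping generators of the solution space, instead of reducing a matrix of equations, suits a
-- sequential machine: an equation may be overwritten once it has been processed, and it costs a
-- single sweep over the generators, without exchanging rows. Because a pivot is added only to later
-- generators and the point stands last, every pivot that is ever added is a direction, so additions
-- do not change final coordinates.
--
-- Correctness is stated for sums over all choices of coefficients of the generators. A sweep turns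
-- the sum restricted by an equation into the unrestricted sum over the new generators, by pairing
-- each vector with its translate by the pivot; the argument runs without ranks or dimensions.
--
-- The answer can be exponential in the number of vertices, so it is kept in binary throughout: the
-- output tape holds 2 to the number of surviving generators, and a deletion halves it by dropping
-- the lowest digit.
--
-- The machine is compiled from a small language with loops, whose semantics tracks a bound on the
-- running time.

Sym : Set
Sym = Symbol 0

-- Normalised tapes

infix 4 _◂_

-- A tape without trailing blanks, so that equal contents are equal terms; the
-- second list starts at the head.
record CTape : Set where
  constructor _◂_
  field
    behind : List Sym
    ahead  : List Sym

infixr 5 _∷′_
_∷′_ : Sym → List Sym → List Sym
blank ∷′ []      = []
blank ∷′ (b ∷ l) = blank ∷ b ∷ l
bit b ∷′ l       = bit b ∷ l

hd : List Sym → Sym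
hd []      = blank
hd (a ∷ _) = a

tl : List Sym → List Sym
tl []      = []
tl (_ ∷ l) = l

read : CTape → Sym
read (_ ◂ r) = hd r

Command : Set
Command = Maybe Sym × Move

keep : Command
keep = nothing , stay

go : Move → Command
go m = nothing , m

put : Sym → Move → Command
put a m = just a , m

-- Staying without writing is a clause of its own, so that `keep` is the identity by computation
-- even on a variable; the runs below can leave the tapes that they do not touch abstract.
obey : Command → CTape → CTape
obey (nothing , stay)  t            = t
obey (just a  , stay)  (l ◂ r)      = l ◂ a ∷′ tl r
obey (w       , right) (l ◂ r)      = fromMaybe (hd r) w ∷′ l ◂ tl r
obey (nothing , left)  (l ◂ r)      = tl l ◂ hd l ∷′ r
obey (just a  , left)  (l ◂ r)      = tl l ◂ hd l ∷′ a ∷′ tl r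

hd-∷′ : ∀ a l → hd (a ∷′ l) ≡ a
hd-∷′ blank   []      = refl
hd-∷′ blank   (_ ∷ _) = refl
hd-∷′ (bit _) _       = refl

tl-∷′ : ∀ a l → tl (a ∷′ l) ≡ l
tl-∷′ blank   []      = refl
tl-∷′ blank   (_ ∷ _) = refl
tl-∷′ (bit _) _       = refl

trim : List Sym → List Sym
trim []      = []
trim (a ∷ l) = a ∷′ trim l

trimTape : Tape 0 → CTape
trimTape (tape l a r) = trim l ◂ trim (a ∷ r)

elaborate : Command → Sym → Sym × Move
elaborate (w , m) a = fromMaybe a w , m

read-trim : ∀ t → read (trimTape t) ≡ Tape.head t
read-trim (tape l a r) = hd-∷′ a (trim r)

obey-trim : ∀ c t → let (a , m) = elaborate c (Tape.head t) in
            trimTape (move m (write a t)) ≡ obey c (trimTape t)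
obey-trim (nothing , left)  (tape []      a r)       = refl
obey-trim (nothing , left)  (tape (b ∷ l) a r)
  rewrite hd-∷′ b (trim l) | tl-∷′ b (trim l)        = refl
obey-trim (nothing , stay)  (tape l       a r)       = refl
obey-trim (nothing , right) (tape l       a [])
  rewrite hd-∷′ a [] | tl-∷′ a []                    = refl
obey-trim (nothing , right) (tape l       a (b ∷ r))
  rewrite hd-∷′ a (b ∷′ trim r) | tl-∷′ a (b ∷′ trim r) = refl
obey-trim (just x  , left)  (tape []      a r)
  rewrite tl-∷′ a (trim r)                           = refl
obey-trim (just x  , left)  (tape (b ∷ l) a r)
  rewrite hd-∷′ b (trim l) | tl-∷′ b (trim l) | tl-∷′ a (trim r) = refl
obey-trim (just x  , stay)  (tape l       a r)
  rewrite tl-∷′ a (trim r)                           = refl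
obey-trim (just x  , right) (tape l       a [])
  rewrite tl-∷′ a []                                 = refl
obey-trim (just x  , right) (tape l       a (b ∷ r))
  rewrite tl-∷′ a (b ∷′ trim r)                      = refl

leadingBits-trim : ∀ l → leadingBits (trim l) ≡ leadingBits l
leadingBits-trim []          = refl
leadingBits-trim (blank ∷ l) with trim l
... | []    = refl
... | _ ∷ _ = refl
leadingBits-trim (bit b ∷ l) = cong (b ∷_) (leadingBits-trim l)

bits : List Bool → List Sym
bits = List.map bit

trim-bits : ∀ w → trim (bits w) ≡ bits w
trim-bits []      = refl
trim-bits (b ∷ w) = cong (bit b ∷_) (trim-bits w)

load-trim : ∀ w → trimTape (load w) ≡ ([] ◂ bits w)
load-trim []      = refl
load-trim (b ∷ w) = cong (λ l → [] ◂ bit b ∷ l) (trim-bits w)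

-- Structured programs

module Language (T : ℕ) where

  Heads Tapes Commands : Set
  Heads    = Vec Sym T
  Tapes    = Vec CTape T
  Commands = Vec Command T

  infixr 4 _⨾_
  data Program : Set where
    perform : (Heads → Commands) → Program
    _⨾_     : Program → Program → Program
    while   : (Heads → Bool) → Program → Program

  heads : Tapes → Heads
  heads = Vec.map read

  obeyAll : (Heads → Commands) → Tapes → Tapes
  obeyAll f ts = Vec.zipWith obey (f (heads ts)) ts

  -- The last index bounds the number of steps.
  data Run : Program → Tapes → Tapes → ℕ → Set where
    run-perform : ∀ {f ts} → Run (perform f) ts (obeyAll f ts) 1
    run-⨾       : ∀ {p q ts us vs m n} → Run p ts us m → Run q us vs n →
                  Run (p ⨾ q) ts vs (m + n)
    run-end     : ∀ {b p ts} → b (heads ts) ≡ false → Run (while b p) ts ts 1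
    run-while   : ∀ {b p ts us vs m n} → b (heads ts) ≡ true →
                  Run p ts us m → Run (while b p) us vs n →
                  Run (while b p) ts vs (suc (m + n))
    run-weaken  : ∀ {p ts us m n} → m ≤ n → Run p ts us m → Run p ts us n

  -- One point per primitive command and per loop test; these become the states of the compiled
  -- machine.
  Point : Program → Set
  Point (perform _) = ⊤
  Point (p ⨾ q)     = Point p ⊎ Point q
  Point (while _ p) = ⊤ ⊎ Point p

  points : Program → ℕ
  points (perform _) = 1
  points (p ⨾ q)     = points p + points q
  points (while _ p) = 1 + points p

  finitePoints : ∀ p → Point p ↔ Fin (points p)
  finitePoints (perform _) = ↔-sym 1↔⊤
  finitePoints (p ⨾ q)     = ↔-trans (finitePoints p ⊎-↔ finitePoints q) (↔-sym +↔⊎)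
  finitePoints (while _ p) = ↔-trans (↔-sym 1↔⊤ ⊎-↔ finitePoints p) (↔-sym +↔⊎)

  entry : ∀ p → Point p
  entry (perform _) = tt
  entry (p ⨾ q)     = inj₁ (entry p)
  entry (while _ p) = inj₁ tt

  idle : Commands
  idle = Vec.replicate T keep

  -- The result nothing means that control leaves the program.
  control : ∀ p → Point p → Heads → Maybe (Point p) × Commands
  control (perform f) tt       hs = nothing , f hs
  control (p ⨾ q)     (inj₁ s) hs =
    let (s′ , c) = control p s hs in just (Maybe.maybe′ inj₁ (inj₂ (entry q)) s′) , c
  control (p ⨾ q)     (inj₂ s) hs =
    let (s′ , c) = control q s hs in Maybe.map inj₂ s′ , c
  control (while b p) (inj₁ _) hs =
    (if b hs then just (inj₂ (entry p)) else nothing) , idle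
  control (while b p) (inj₂ s) hs =
    let (s′ , c) = control p s hs in just (Maybe.maybe′ inj₂ (inj₁ tt) s′) , c

  -- The small-step counterpart of `Run`, from any control point until control leaves `p`, with an
  -- exact count of steps in place of a bound.
  data Exits (p : Program) : Point p → Tapes → Tapes → ℕ → Set where
    exit     : ∀ {s ts c} → control p s (heads ts) ≡ (nothing , c) →
               Exits p s ts (Vec.zipWith obey c ts) 1
    continue : ∀ {s s′ ts us c n} → control p s (heads ts) ≡ (just s′ , c) →
               Exits p s′ (Vec.zipWith obey c ts) us n → Exits p s ts us (suc n)

  obey-idle : ∀ {n} (ts : Vec CTape n) → Vec.zipWith obey (Vec.replicate n keep) ts ≡ ts
  obey-idle []       = refl
  obey-idle (t ∷ ts) = cong (t ∷_) (obey-idle ts)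

  exits-inj₂ : ∀ {p q s ts us n} → Exits q s ts us n → Exits (p ⨾ q) (inj₂ s) ts us n
  exits-inj₂ (exit e)       = exit (cong (λ (s , c) → Maybe.map inj₂ s , c) e)
  exits-inj₂ (continue e x) =
    continue (cong (λ (s , c) → Maybe.map inj₂ s , c) e) (exits-inj₂ x)

  -- The step that leaves `p` already enters `q`, so the times add up without overhead.
  exits-⨾ : ∀ {p q s ts us vs m n} → Exits p s ts us m → Exits q (entry q) us vs n →
            Exits (p ⨾ q) (inj₁ s) ts vs (m + n)
  exits-⨾ {q = q} (exit e) y =
    continue (cong (λ (s , c) → just (Maybe.maybe′ inj₁ (inj₂ (entry q)) s) , c) e)
             (exits-inj₂ y)
  exits-⨾ {q = q} (continue e x) y =
    continue (cong (λ (s , c) → just (Maybe.maybe′ inj₁ (inj₂ (entry q)) s) , c) e)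
             (exits-⨾ x y)

  exits-body : ∀ {b p s ts us vs m n} → Exits p s ts us m →
               Exits (while b p) (inj₁ tt) us vs n →
               Exits (while b p) (inj₂ s) ts vs (m + n)
  exits-body (exit e) y =
    continue (cong (λ (s , c) → just (Maybe.maybe′ inj₂ (inj₁ tt) s) , c) e) y
  exits-body (continue e x) y =
    continue (cong (λ (s , c) → just (Maybe.maybe′ inj₂ (inj₁ tt) s) , c) e) (exits-body x y)

  run⇒exits : ∀ {p ts us n} → Run p ts us n → ∃[ m ] m ≤ n × Exits p (entry p) ts us m
  run⇒exits run-perform = 1 , ≤-refl , exit refl
  run⇒exits (run-⨾ x y) with run⇒exits x | run⇒exits y
  ... | m , m≤ , x′ | n , n≤ , y′ = m + n , +-mono-≤ m≤ n≤ , exits-⨾ x′ y′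
  run⇒exits {while b p} {ts} (run-end e) = 1 , ≤-refl ,
    subst (λ us → Exits (while b p) (inj₁ tt) ts us 1) (obey-idle ts)
      (exit (cong (λ x → (if x then just (inj₂ (entry p)) else nothing) , idle) e))
  run⇒exits {while b p} {ts} (run-while e x y) with run⇒exits x | run⇒exits y
  ... | m , m≤ , x′ | n , n≤ , y′ = suc (m + n) , s≤s (+-mono-≤ m≤ n≤) ,
    continue (cong (λ x → (if x then just (inj₂ (entry p)) else nothing) , idle) e)
      (subst (λ us → Exits (while b p) (inj₂ (entry p)) us _ (m + n)) (sym (obey-idle ts))
        (exits-body x′ y′))
  run⇒exits (run-weaken m≤n x) with run⇒exits x
  ... | l , l≤m , x′ = l , ≤-trans l≤m m≤n , x′

-- Compilation to Turing machines

module _ {w : ℕ} where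
  open Language (2 + w)

  compile : Program → TuringMachine
  compile p = record
    { State     = ⊤ ⊎ Point p
    ; states    = 1 + points p
    ; finite    = ↔-trans (↔-sym 1↔⊤ ⊎-↔ finitePoints p) (↔-sym +↔⊎)
    ; extras    = 0
    ; workTapes = w
    ; start     = inj₂ (entry p)
    -- `inj₁ tt` is the halting state. A step that leaves the program still acts on the tapes, hence
    -- it needs a successor state.
    ; δ         = λ where
        (inj₁ _) hs → nothing
        (inj₂ s) hs → let (s′ , c) = control p s hs in
          just (Maybe.maybe′ inj₂ (inj₁ tt) s′ , Vec.zipWith elaborate c hs)
    }

  private
    trimAll : ∀ {n} → Vec (Tape 0) n → Vec CTape n
    trimAll = Vec.map trimTape

    read-trimAll : ∀ {n} (ts : Vec (Tape 0) n) →
                   Vec.map read (trimAll ts) ≡ Vec.map Tape.head ts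
    read-trimAll []       = refl
    read-trimAll (t ∷ ts) = cong₂ _∷_ (read-trim t) (read-trimAll ts)

    actOn : Sym × Move → Tape 0 → Tape 0
    actOn (a , m) t = move m (write a t)

    obey-trimAll : ∀ {n} (cs : Vec Command n) (ts : Vec (Tape 0) n) →
      trimAll (Vec.zipWith actOn (Vec.zipWith elaborate cs (Vec.map Tape.head ts)) ts) ≡
      Vec.zipWith obey cs (trimAll ts)
    obey-trimAll []       []       = refl
    obey-trimAll (c ∷ cs) (t ∷ ts) = cong₂ _∷_ (obey-trim c t) (obey-trimAll cs ts)

    empties : ∀ n → trimAll (Vec.replicate n emptyTape) ≡ Vec.replicate n ([] ◂ [])
    empties zero    = refl
    empties (suc n) = cong (_ ∷_) (empties n)

    unload-trimAll : ∀ (ts : Vec (Tape 0) (2 + w)) → unload (Vec.lookup ts (Fin.suc Fin.zero)) ≡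
      leadingBits (CTape.ahead (Vec.lookup (trimAll ts) (Fin.suc Fin.zero)))
    unload-trimAll (_ ∷ tape l a r ∷ _) = sym (leadingBits-trim (a ∷ r))

  module _ (p : Program) where
    open TuringMachine (compile p)

    private
      step-control : ∀ {s s′ c} ts → control p s (heads (trimAll ts)) ≡ (s′ , c) →
        step (inj₂ s , ts) ≡
        just (Maybe.maybe′ inj₂ (inj₁ tt) s′ ,
              Vec.zipWith actOn (Vec.zipWith elaborate c (Vec.map Tape.head ts)) ts)
      step-control ts e rewrite read-trimAll ts | e = refl

    exits⇒halts : ∀ {s us n} ts → Exits p s (trimAll ts) us n →
      ∃[ c ] (inj₂ s , ts) HaltsIn n At c × trimAll (proj₂ c) ≡ us
    exits⇒halts ts (exit {c = c} e) =
      _ , next (step-control ts e) (halt refl) , obey-trimAll c ts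
    exits⇒halts ts (continue {c = c} e x)
      with c′ , h , eq ← exits⇒halts _
             (subst (λ us → Exits p _ us _ _) (sym (obey-trimAll c ts)) x)
      = c′ , next (step-control ts e) h , eq

    run⇒halts : ∀ {us n} v → Run p (([] ◂ bits v) ∷ Vec.replicate _ ([] ◂ [])) us n →
      ∃[ m ] ∃[ c ] initial v HaltsIn m At c ×
        output c ≡ leadingBits (CTape.ahead (Vec.lookup us (Fin.suc Fin.zero))) × m ≤ n
    run⇒halts {us} v r
      with m , m≤n , x ← run⇒exits r
      with c , h , refl ← exits⇒halts (load v ∷ Vec.replicate _ emptyTape)
             (subst (λ ts → Exits p (entry p) ts us m)
               (cong₂ _∷_ (sym (load-trim v)) (sym (empties _))) x)
      = m , c , h , unload-trimAll (proj₂ c) , m≤n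

  run⇒polynomialTime : ∀ {A : Set} {encode : A → List Bool} {size F} p C d →
    (∀ a → ∃[ us ] ∃[ n ] Run p (([] ◂ bits (encode a)) ∷ Vec.replicate _ ([] ◂ [])) us n ×
      binaryValue (leadingBits (CTape.ahead (Vec.lookup us (Fin.suc Fin.zero)))) ≡ F a ×
      n ≤ C * suc (size a) ^ d) →
    PolynomialTime encode size F
  run⇒polynomialTime {encode = encode} p C d runs = record
    { machine  = compile p
    ; C        = C
    ; d        = d
    ; computes = λ a →
        let us , n , r , value , n≤ = runs a
            m , c , h , o , m≤n = run⇒halts p (encode a) r
        in m , c , h , trans (cong binaryValue o) value , ≤-trans m≤n n≤
    }

-- Linear algebra over the field with two elements

infixl 6 _⊕_
_⊕_ : ∀ {n} → Vec Bool n → Vec Bool n → Vec Bool n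
_⊕_ = Vec.zipWith _xor_

zeros : ∀ n → Vec Bool n
zeros n = Vec.replicate n false

dot : ∀ {n} → Vec Bool n → Vec Bool n → Bool
dot []      []      = false
dot (a ∷ u) (b ∷ v) = (a ∧ b) xor dot u v

⊕-assoc : ∀ {n} (u v w : Vec Bool n) → (u ⊕ v) ⊕ w ≡ u ⊕ (v ⊕ w)
⊕-assoc = Vecₚ.zipWith-assoc xor-assoc

⊕-comm : ∀ {n} (u v : Vec Bool n) → u ⊕ v ≡ v ⊕ u
⊕-comm = Vecₚ.zipWith-comm xor-comm

⊕-cancelʳ : ∀ {n} (u v : Vec Bool n) → (u ⊕ v) ⊕ v ≡ u
⊕-cancelʳ []      []      = refl
⊕-cancelʳ (a ∷ u) (b ∷ v) = cong₂ _∷_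
  (trans (xor-assoc a b b) (trans (cong (a xor_) (xor-same b)) (xor-identityʳ a)))
  (⊕-cancelʳ u v)

⊕-swapʳ : ∀ {n} (u v w : Vec Bool n) → (u ⊕ v) ⊕ w ≡ (u ⊕ w) ⊕ v
⊕-swapʳ u v w = trans (⊕-assoc u v w) (trans (cong (u ⊕_) (⊕-comm v w)) (sym (⊕-assoc u w v)))

dot-zeroˡ : ∀ {n} (v : Vec Bool n) → dot (zeros n) v ≡ false
dot-zeroˡ []      = refl
dot-zeroˡ (_ ∷ v) = dot-zeroˡ v

dot-zeroʳ : ∀ {n} (u : Vec Bool n) → dot u (zeros n) ≡ false
dot-zeroʳ []      = refl
dot-zeroʳ (a ∷ u) rewrite ∧-zeroʳ a = dot-zeroʳ u

dot-⊕ : ∀ {n} (r u v : Vec Bool n) → dot r (u ⊕ v) ≡ dot r u xor dot r v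
dot-⊕ []      []      []      = refl
dot-⊕ (a ∷ r) (b ∷ u) (c ∷ v) rewrite ∧-distribˡ-xor a b c | dot-⊕ r u v =
  xor-interchange (a ∧ b) (a ∧ c) (dot r u) (dot r v)

dot-∷ʳ : ∀ {n} (u v : Vec Bool n) c → dot (u ∷ʳ c) (v ∷ʳ true) ≡ dot u v xor c
dot-∷ʳ []      []      false = refl
dot-∷ʳ []      []      true  = refl
dot-∷ʳ (a ∷ u) (b ∷ v) c
  rewrite dot-∷ʳ u v c = sym (xor-assoc (a ∧ b) (dot u v) c)

last-⊕ : ∀ {n} (u v : Vec Bool (suc n)) → Vec.last (u ⊕ v) ≡ Vec.last u xor Vec.last v
last-⊕ (_ ∷ [])        (_ ∷ [])        = refl
last-⊕ (_ ∷ u@(_ ∷ _)) (_ ∷ v@(_ ∷ _)) = last-⊕ u v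

last-zeros : ∀ n → Vec.last (zeros (suc n)) ≡ false
last-zeros zero    = refl
last-zeros (suc n) = last-zeros n

units : ∀ n → List (Vec Bool n)
units zero    = []
units (suc n) = (true ∷ zeros n) ∷ List.map (false ∷_) (units n)

ind : Bool → ℕ
ind b = if b then 1 else 0

ind-∧ : ∀ a b → ind (a ∧ b) ≡ ind a * ind b
ind-∧ false b = refl
ind-∧ true  b = sym (+-identityʳ (ind b))

-- Spans of generators, some of which have been deleted

Row : ℕ → Set
Row n = Maybe (Vec Bool n)

-- Each choice of coefficients contributes a term, even if two choices give the same vector. This
-- multiplicity is what lets a sweep be verified by regrouping sums.
spanSum : ∀ {n} → (Vec Bool n → ℕ) → Vec Bool n → List (Row n) → ℕ
spanSum φ x []             = φ x
spanSum φ x (nothing ∷ gs) = spanSum φ x gs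
spanSum φ x (just g  ∷ gs) = spanSum φ x gs + spanSum φ (x ⊕ g) gs

spanSum-cong : ∀ {n} {φ ψ : Vec Bool n → ℕ} → (∀ v → φ v ≡ ψ v) →
               ∀ x gs → spanSum φ x gs ≡ spanSum ψ x gs
spanSum-cong e x []             = e x
spanSum-cong e x (nothing ∷ gs) = spanSum-cong e x gs
spanSum-cong e x (just g  ∷ gs) =
  cong₂ _+_ (spanSum-cong e x gs) (spanSum-cong e (x ⊕ g) gs)

live : ∀ {n} → List (Row n) → ℕ
live []             = 0
live (nothing ∷ gs) = live gs
live (just _  ∷ gs) = suc (live gs)

-- The Boolean says whether the generator violates the equation.

nextRow : ∀ {n} → Bool → Row n → Vec Bool n → Row n
nextRow false _        g = just g
nextRow true  nothing  g = nothing
nextRow true  (just p) g = just (g ⊕ p)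

nextPivot : ∀ {n} → Bool → Row n → Vec Bool n → Row n
nextPivot false q        g = q
nextPivot true  nothing  g = just g
nextPivot true  (just p) g = just p

pass : ∀ {n} → Row n → Vec Bool n → List (Row n) → List (Row n)
pass q r []             = []
pass q r (nothing ∷ gs) = nothing ∷ pass q r gs
pass q r (just g  ∷ gs) = nextRow (dot r g) q g ∷ pass (nextPivot (dot r g) q g) r gs

restrict : ∀ {n} → Vec Bool n → (Vec Bool n → ℕ) → Vec Bool n → ℕ
restrict r φ v = if dot r v then 0 else φ v

module _ {n : ℕ} (r : Vec Bool n) (φ : Vec Bool n → ℕ) where

  private
    ψ = restrict r φ

  -- Of any two vectors that differ by `p`, exactly one satisfies the equation. Adding `p` to the
  -- violating generators makes every combination based at `x` the satisfying one of its pair.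
  spanSum-pivot : ∀ p → dot r p ≡ true → ∀ x → dot r x ≡ false → ∀ gs →
    spanSum ψ x gs + spanSum ψ (x ⊕ p) gs ≡ spanSum φ x (pass (just p) r gs)
  spanSum-pivot p rp x rx []
    rewrite dot-⊕ r x p | rx | rp = +-identityʳ (φ x)
  spanSum-pivot p rp x rx (nothing ∷ gs) = spanSum-pivot p rp x rx gs
  spanSum-pivot p rp x rx (just g ∷ gs) with dot r g in rg
  ... | false = begin
    (S x + S (x ⊕ g)) + (S (x ⊕ p) + S ((x ⊕ p) ⊕ g))
      ≡⟨ cong (λ y → (S x + S (x ⊕ g)) + (S (x ⊕ p) + S y)) (⊕-swapʳ x p g) ⟩
    (S x + S (x ⊕ g)) + (S (x ⊕ p) + S ((x ⊕ g) ⊕ p))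
      ≡⟨ interchange (S x) (S (x ⊕ g)) (S (x ⊕ p)) _ ⟩
    (S x + S (x ⊕ p)) + (S (x ⊕ g) + S ((x ⊕ g) ⊕ p))
      ≡⟨ cong₂ _+_ (spanSum-pivot p rp x rx gs)
                   (spanSum-pivot p rp (x ⊕ g) (trans (dot-⊕ r x g) (cong₂ _xor_ rx rg)) gs) ⟩
    _ ∎
    where
    open ≡-Reasoning
    S = λ y → spanSum ψ y gs
  -- The translates of `x` by combinations of `g` and `p` regroup into two pairs that differ by `p`,
  -- based at `x` and at `x ⊕ (g ⊕ p)`, which both satisfy the equation.
  ... | true = begin
    (S x + S (x ⊕ g)) + (S (x ⊕ p) + S ((x ⊕ p) ⊕ g))
      ≡⟨ cong₂ (λ y z → (S x + S y) + (S (x ⊕ p) + S z))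
               (trans (sym (⊕-cancelʳ (x ⊕ g) p)) (cong (_⊕ p) (⊕-assoc x g p)))
               (trans (⊕-swapʳ x p g) (⊕-assoc x g p)) ⟩
    (S x + S (x ⊕ (g ⊕ p) ⊕ p)) + (S (x ⊕ p) + S (x ⊕ (g ⊕ p)))
      ≡⟨ cong ((S x + S (x ⊕ (g ⊕ p) ⊕ p)) +_) (+-comm (S (x ⊕ p)) _) ⟩
    (S x + S (x ⊕ (g ⊕ p) ⊕ p)) + (S (x ⊕ (g ⊕ p)) + S (x ⊕ p))
      ≡⟨ cong (_+ (S (x ⊕ (g ⊕ p)) + S (x ⊕ p))) (+-comm (S x) _) ⟩
    (S (x ⊕ (g ⊕ p) ⊕ p) + S x) + (S (x ⊕ (g ⊕ p)) + S (x ⊕ p))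
      ≡⟨ interchange (S (x ⊕ (g ⊕ p) ⊕ p)) (S x) (S (x ⊕ (g ⊕ p))) _ ⟩
    (S (x ⊕ (g ⊕ p) ⊕ p) + S (x ⊕ (g ⊕ p))) + (S x + S (x ⊕ p))
      ≡⟨ cong₂ _+_ (+-comm _ (S (x ⊕ (g ⊕ p)))) refl ⟩
    (S (x ⊕ (g ⊕ p)) + S (x ⊕ (g ⊕ p) ⊕ p)) + (S x + S (x ⊕ p))
      ≡⟨ +-comm _ (S x + S (x ⊕ p)) ⟩
    (S x + S (x ⊕ p)) + (S (x ⊕ (g ⊕ p)) + S (x ⊕ (g ⊕ p) ⊕ p))
      ≡⟨ cong₂ _+_ (spanSum-pivot p rp x rx gs) (spanSum-pivot p rp (x ⊕ (g ⊕ p)) rxgp gs) ⟩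
    _ ∎
    where
    open ≡-Reasoning
    S = λ y → spanSum ψ y gs
    rxgp : dot r (x ⊕ (g ⊕ p)) ≡ false
    rxgp rewrite dot-⊕ r x (g ⊕ p) | dot-⊕ r g p | rx | rg | rp = refl

  -- Adding a generator that respects the equation keeps the base point a solution. At the first
  -- violating `g`, the two halves of the sum are the left side of `spanSum-pivot` with `g` as the
  -- pivot.
  spanSum-pass : ∀ x → dot r x ≡ false → ∀ gs →
    spanSum ψ x gs ≡ spanSum φ x (pass nothing r gs)
  spanSum-pass x rx [] rewrite rx = refl
  spanSum-pass x rx (nothing ∷ gs) = spanSum-pass x rx gs
  spanSum-pass x rx (just g ∷ gs) with dot r g in rg
  ... | false = cong₂ _+_ (spanSum-pass x rx gs)
                  (spanSum-pass (x ⊕ g) (trans (dot-⊕ r x g) (cong₂ _xor_ rx rg)) gs)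
  ... | true  = spanSum-pivot g rg x rx gs

-- All generators but the last are directions (final coordinate 0); the last one,
-- if still present, is a point (final coordinate 1).
data Shaped {n : ℕ} : List (Row (suc n)) → Bool → Set where
  dead      : Shaped (nothing ∷ []) false
  alive     : ∀ {p} → Vec.last p ≡ true → Shaped (just p ∷ []) true
  deleted   : ∀ {gs b} → Shaped gs b → Shaped (nothing ∷ gs) b
  direction : ∀ {g gs b} → Vec.last g ≡ false → Shaped gs b → Shaped (just g ∷ gs) b

units-shaped : ∀ n → Shaped (List.map just (units (suc n))) true
units-shaped zero    = alive refl
units-shaped (suc n) = direction (last-zeros n) (false∷-shaped (units-shaped n))
  where
  false∷-shaped : ∀ {n} {gs : List (Vec Bool (suc n))} {b} → Shaped (List.map just gs) b →
                  Shaped (List.map just (List.map (false ∷_) gs)) b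
  false∷-shaped {gs = _ ∷ []}    (alive e)       = alive e
  false∷-shaped {gs = _ ∷ []}    (direction e s) = direction e (false∷-shaped s)
  false∷-shaped {gs = _ ∷ _ ∷ _} (direction e s) = direction e (false∷-shaped s)

-- A generator that becomes the pivot before the end of the list is a direction, and adding a
-- direction leaves final coordinates alone. If the point itself is the first to violate the
-- equation, it is deleted and the shape becomes `false`.
pass-shaped : ∀ {n q} (r : Vec Bool (suc n)) {gs b} →
  MaybeAll.All (λ p → Vec.last p ≡ false) q → Shaped gs b →
  ∃[ b′ ] Shaped (pass q r gs) b′
pass-shaped r q dead = _ , dead
pass-shaped r q (alive {p} e) with dot r p | q
... | false | _       = _ , alive e
... | true  | nothing = _ , dead
... | true  | just {x = u} eq = _ , alive (trans (last-⊕ p u) (cong₂ _xor_ e eq))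
pass-shaped r q (deleted s) with _ , s′ ← pass-shaped r q s = _ , deleted s′
pass-shaped r q (direction {g} e s) with dot r g | q
... | false | q       with _ , s′ ← pass-shaped r q s = _ , direction e s′
... | true  | nothing with _ , s′ ← pass-shaped r (just e) s = _ , deleted s′
... | true  | just {x = u} eq with _ , s′ ← pass-shaped r (just eq) s =
  _ , direction (trans (last-⊕ g u) (cong₂ _xor_ e eq)) s′

live-shaped : ∀ {n} {gs : List (Row (suc n))} → Shaped gs true → live gs ≡ suc (pred (live gs))
live-shaped (alive _)       = refl
live-shaped (deleted s)     = live-shaped s
live-shaped (direction _ _) = refl

-- Final coordinate 1 forces the coefficient of the point to be 1, while those of the directions are
-- free; without the point, no combination reaches it.
spanSum-shaped : ∀ {n} {gs : List (Row (suc n))} {b} → Shaped gs b →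
  ∀ x → Vec.last x ≡ false →
  spanSum (ind ∘ Vec.last) x gs ≡ (if b then 2 ^ pred (live gs) else 0)
spanSum-shaped dead x e rewrite e = refl
spanSum-shaped (alive {p} ep) x e rewrite last-⊕ x p | e | ep = refl
spanSum-shaped (deleted s) x e = spanSum-shaped s x e
spanSum-shaped (direction {g} {b = false} eg s) x e =
  cong₂ _+_ (spanSum-shaped s x e)
            (spanSum-shaped s (x ⊕ g) (trans (last-⊕ x g) (cong₂ _xor_ e eg)))
spanSum-shaped (direction {g} {gs} {true} eg s) x e
  rewrite spanSum-shaped s x e
        | spanSum-shaped s (x ⊕ g) (trans (last-⊕ x g) (cong₂ _xor_ e eg))
        | live-shaped s
        = cong (2 ^ pred (live gs) +_) (sym (+-identityʳ (2 ^ pred (live gs))))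

spanSum-false∷ : ∀ {n} (φ : Vec Bool (suc n) → ℕ) b x gs →
  spanSum φ (b ∷ x) (List.map just (List.map (false ∷_) gs)) ≡
  spanSum (φ ∘ (b ∷_)) x (List.map just gs)
spanSum-false∷ φ b x []       = refl
spanSum-false∷ φ b x (g ∷ gs) rewrite xor-identityʳ b =
  cong₂ _+_ (spanSum-false∷ φ b x gs) (spanSum-false∷ φ b (x ⊕ g) gs)

-- The extended assignments are only half of the space. As `φ` vanishes on the other half, the sum
-- may run over all combinations of unit vectors, and the first unit vector splits it by the first
-- coordinate.
sum-assignments : ∀ n (φ : Vec Bool (suc n) → ℕ) → (∀ v → Vec.last v ≡ false → φ v ≡ 0) →
  sum (List.map (φ ∘ (_∷ʳ true)) (assignments n)) ≡
  spanSum φ (zeros (suc n)) (List.map just (units (suc n)))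
sum-assignments zero    φ φ0 rewrite φ0 (false ∷ []) refl = +-identityʳ _
sum-assignments (suc n) φ φ0 = begin
  sum (List.map Φ (List.map (false ∷_) A ++ List.map (true ∷_) A))
    ≡⟨ cong sum (Listₚ.map-++ Φ (List.map (false ∷_) A) _) ⟩
  sum (List.map Φ (List.map (false ∷_) A) ++ List.map Φ (List.map (true ∷_) A))
    ≡⟨ sum-++ (List.map Φ (List.map (false ∷_) A)) _ ⟩
  sum (List.map Φ (List.map (false ∷_) A)) + sum (List.map Φ (List.map (true ∷_) A))
    ≡⟨ cong₂ _+_ (half false) (half true) ⟩
  spanSum φ (false ∷ o) G + spanSum φ (true ∷ o) G
    ≡⟨ cong (λ x → spanSum φ (false ∷ o) G + spanSum φ (true ∷ x) G)
         (sym (Vecₚ.zipWith-identityˡ xor-identityˡ o)) ⟩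
  spanSum φ (false ∷ o) G + spanSum φ ((false ∷ o) ⊕ (true ∷ o)) G ∎
  where
  open ≡-Reasoning
  A = assignments n
  Φ = φ ∘ (_∷ʳ true)
  o = zeros (suc n)
  G = List.map just (List.map (false ∷_) (units (suc n)))
  half : ∀ b → sum (List.map Φ (List.map (b ∷_) A)) ≡ spanSum φ (b ∷ o) G
  half b = trans (cong sum (sym (Listₚ.map-∘ A)))
    (trans (sum-assignments n (φ ∘ (b ∷_)) λ { v@(_ ∷ _) e → φ0 (b ∷ v) e })
           (sym (spanSum-false∷ φ b o (units (suc n)))))

-- Elimination and the number of solutions

eliminate : ∀ {n} → List (Row n) → List (Vec Bool n) → List (Row n)
eliminate = List.foldl (λ gs r → pass nothing r gs)

eliminate-shaped : ∀ {n gs b} (rs : List (Vec Bool (suc n))) → Shaped gs b →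
  ∃[ b′ ] Shaped (eliminate gs rs) b′
eliminate-shaped []       s = _ , s
eliminate-shaped (r ∷ rs) s = eliminate-shaped rs (proj₂ (pass-shaped r nothing s))

vanishes : ∀ {n} → List (Vec Bool n) → Vec Bool n → Bool
vanishes rs v = all (λ r → not (dot r v)) rs

solutions : ∀ {n} → List (Vec Bool (suc n)) → ℕ
solutions {n} rs = sum (List.map (λ σ → ind (vanishes rs (σ ∷ʳ true))) (assignments n))

-- The equations move one at a time from the summand into the generators. The base point zero solves
-- each of them, as `spanSum-pass` demands.
spanSum-eliminate : ∀ {n} (rs : List (Vec Bool (suc n))) gs →
  spanSum (λ v → ind (vanishes rs v ∧ Vec.last v)) (zeros (suc n)) gs ≡
  spanSum (ind ∘ Vec.last) (zeros (suc n)) (eliminate gs rs)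
spanSum-eliminate []       gs = refl
spanSum-eliminate (r ∷ rs) gs =
  trans (spanSum-cong cell (zeros _) gs)
    (trans (spanSum-pass r _ (zeros _) (dot-zeroʳ r) gs)
           (spanSum-eliminate rs (pass nothing r gs)))
  where
  cell : ∀ v → ind (vanishes (r ∷ rs) v ∧ Vec.last v) ≡
               restrict r (λ v → ind (vanishes rs v ∧ Vec.last v)) v
  cell v with dot r v
  ... | false = refl
  ... | true  = refl

solutions-eliminate : ∀ {n} (rs : List (Vec Bool (suc n))) →
  solutions rs ≡ spanSum (ind ∘ Vec.last) (zeros (suc n))
                         (eliminate (List.map just (units (suc n))) rs)
solutions-eliminate {n} rs =
  trans (cong sum (Listₚ.map-cong final (assignments n)))
    (trans (sum-assignments n φ φ0) (spanSum-eliminate rs _))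
  where
  φ : Vec Bool (suc n) → ℕ
  φ v = ind (vanishes rs v ∧ Vec.last v)
  φ0 : ∀ v → Vec.last v ≡ false → φ v ≡ 0
  φ0 v e rewrite e | ∧-zeroʳ (vanishes rs v) = refl
  final : ∀ σ → ind (vanishes rs (σ ∷ʳ true)) ≡ φ (σ ∷ʳ true)
  final σ rewrite Vecₚ.last-∷ʳ true σ with vanishes rs (σ ∷ʳ true)
  ... | false = refl
  ... | true  = refl

-- Systems of affine equations

Equation : ℕ → Set
Equation k = Vec Bool k × Bool

holds : ∀ {k} → Vec Bool k → Equation k → Bool
holds x (s , c) = not (dot s x xor c)

solves : ∀ {k} → List (Equation k) → Vec Bool k → Bool
solves L x = all (holds x) L

weaken : ∀ {k} → Equation k → Equation (suc k)
weaken (s , c) = (false ∷ s) , c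

solves-weaken : ∀ {k} (L : List (Equation k)) a x →
                solves (List.map weaken L) (a ∷ x) ≡ solves L x
solves-weaken []       a x = refl
solves-weaken (e ∷ L) a x = cong (holds x e ∧_) (solves-weaken L a x)

∧-true : ∀ {a b} → a ∧ b ≡ true → a ≡ true × b ≡ true
∧-true {true} {true} _ = refl , refl

pins : Bool → ∀ k → List (Equation k)
pins c zero    = []
pins c (suc k) = ((true ∷ zeros k) , c) ∷ List.map weaken (pins c k)

pins⇒All : ∀ c {k} (x : Vec Bool k) → solves (pins c k) x ≡ true → All (_≡ c) x
pins⇒All c []      _ = []
pins⇒All c (a ∷ x) e rewrite dot-zeroˡ x | solves-weaken (pins c _) a x =
  here a c (proj₁ (∧-true e)) ∷ pins⇒All c x (proj₂ (∧-true {not ((a xor false) xor c)} e))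
  where
  here : ∀ a c → not ((a xor false) xor c) ≡ true → a ≡ c
  here false false _ = refl
  here true  true  _ = refl

All⇒pins : ∀ c {k} {x : Vec Bool k} → All (_≡ c) x → solves (pins c k) x ≡ true
All⇒pins c [] = refl
All⇒pins c {x = a ∷ x} (refl ∷ e)
  rewrite dot-zeroˡ x | xor-identityʳ c | xor-same c | solves-weaken (pins c _) c x =
  All⇒pins c e

-- Equality of all coordinates, expressed through neighbours only.
links : ∀ k → List (Equation k)
links zero          = []
links (suc zero)    = []
links (suc (suc k)) = ((true ∷ true ∷ zeros k) , false) ∷ List.map weaken (links (suc k))

Constant : ∀ {k} → Vec Bool k → Set
Constant x = ∀ i j → Vec.lookup x i ≡ Vec.lookup x j

link : ∀ a b → not ((a xor (b xor false)) xor false) ≡ true → b ≡ a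
link false false _ = refl
link true  true  _ = refl

unlink : ∀ a b → b ≡ a → not ((a xor (b xor false)) xor false) ≡ true
unlink false _ refl = refl
unlink true  _ refl = refl

links⇒All : ∀ {k} a (x : Vec Bool k) → solves (links (suc k)) (a ∷ x) ≡ true → All (_≡ a) x
links⇒All a []      _ = []
links⇒All a (b ∷ x) e rewrite dot-zeroˡ x | solves-weaken (links _) a (b ∷ x)
  with e₁ , e₂ ← ∧-true e with refl ← link a b e₁ = refl ∷ links⇒All a x e₂

links⇒Constant : ∀ {k} (x : Vec Bool k) → solves (links k) x ≡ true → Constant x
links⇒Constant (a ∷ x) e i j =
  trans (VecAll.lookup same (∈-lookup i _)) (sym (VecAll.lookup same (∈-lookup j _)))
  where
  same : All (_≡ a) (a ∷ x)
  same = refl ∷ links⇒All a x e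

Constant⇒links : ∀ {k} (x : Vec Bool k) → Constant x → solves (links k) x ≡ true
Constant⇒links []          _ = refl
Constant⇒links (_ ∷ [])    _ = refl
Constant⇒links (a ∷ b ∷ x) e = cong₂ _∧_
  (trans (cong (λ d → not ((a xor (b xor d)) xor false)) (dot-zeroˡ x))
         (unlink a b (e (suc zero) zero)))
  (trans (solves-weaken (links _) a (b ∷ x)) (Constant⇒links (b ∷ x) λ i j → e (suc i) (suc j)))

dot-ones : ∀ {k} (x : Vec Bool k) → dot (Vec.replicate k true) x ≡ ⨁ x
dot-ones []      = refl
dot-ones (a ∷ x) = cong (a xor_) (dot-ones x)

-- `IsIndicator` alone does not decide `P`; the Boolean `b` supplies the decision.
indicator : ∀ {k} {g : Vec Bool k → ℕ} {P} → IsIndicator g P → ∀ {x} b →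
            (b ≡ true → P x) → (P x → b ≡ true) → g x ≡ ind b
indicator I true  f g = proj₁ (I _) (f refl)
indicator I false f g = proj₂ (I _) λ p → contradiction (g p) λ ()

parity : ∀ {k} c (x : Vec Bool k) →
  (solves ((Vec.replicate k true , c) ∷ []) x ≡ true → ⨁ x ≡ c) ×
  (⨁ x ≡ c → solves ((Vec.replicate k true , c) ∷ []) x ≡ true)
parity c x rewrite dot-ones x = equal (⨁ x) c
  where
  equal : ∀ a c → (not (a xor c) ∧ true ≡ true → a ≡ c) × (a ≡ c → not (a xor c) ∧ true ≡ true)
  equal false false = (λ _ → refl) , λ _ → refl
  equal false true  = (λ ()) , λ ()
  equal true  false = (λ ()) , λ ()
  equal true  true  = (λ _ → refl) , λ _ → refl

easy⇒affine : ∀ {k} {f : SymmetricFunction k} → EASY f →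
  ∃[ L ] ∀ x → SymmetricFunction.fun f x ≡ ind (solves L x)
-- The inconsistent equation 0 = 1.
easy⇒affine {k} (const-0 e) = (zeros k , true) ∷ [] , λ x →
  trans (e x) (cong (λ b → ind (not (b xor true) ∧ true)) (sym (dot-zeroˡ x)))
easy⇒affine (const-1 e)   = [] , e
easy⇒affine (all-0 I)     = pins false _ , λ x → indicator I _ (pins⇒All false x) (All⇒pins false)
easy⇒affine (all-1 I)     = pins true _ , λ x → indicator I _ (pins⇒All true x) (All⇒pins true)
easy⇒affine (all-equal I) = links _ , λ x → indicator I _ (links⇒Constant x) (Constant⇒links x)
easy⇒affine (even I)      = (Vec.replicate _ true , false) ∷ [] , λ x →
  indicator I _ (proj₁ (parity false x)) (proj₂ (parity false x))
easy⇒affine (odd I)       = (Vec.replicate _ true , true) ∷ [] , λ x →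
  indicator I _ (proj₁ (parity true x)) (proj₂ (parity true x))

expand : ∀ {n} (e : Subset n) → Vec Bool ∣ e ∣ → Vec Bool n
expand []            []      = []
expand (inside  ∷ e) (b ∷ s) = b ∷ expand e s
expand (outside ∷ e) s       = false ∷ expand e s

-- Extending coefficients by zero is adjoint to restricting assignments to the members of `e`; both
-- follow the members in increasing order.
dot-expand : ∀ {n} (e : Subset n) s σ →
             dot s (Vec.map (Vec.lookup σ) (members e)) ≡ dot (expand e s) σ
dot-expand []            []      []      = refl
dot-expand (inside  ∷ e) (b ∷ s) (a ∷ σ) = cong ((b ∧ a) xor_)
  (trans (cong (dot s) (sym (Vecₚ.map-∘ (Vec.lookup (a ∷ σ)) suc (members e)))) (dot-expand e s σ))
dot-expand (outside ∷ e) s       (a ∷ σ) =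
  trans (cong (dot s) (sym (Vecₚ.map-∘ (Vec.lookup (a ∷ σ)) suc (members e)))) (dot-expand e s σ)

module _ {k n : ℕ} where

  coefficients : Hyperedge k n → Vec Bool k → Vec Bool n
  coefficients (e , refl) = expand e

  row : Hyperedge k n → Equation k → Vec Bool (suc n)
  row e (s , c) = coefficients e s ∷ʳ c

  rows : List (Equation k) → List (Hyperedge k n) → List (Vec Bool (suc n))
  rows L = List.concatMap (λ e → List.map (row e) L)

  dot-row : ∀ (e : Hyperedge k n) s c σ →
    dot (row e (s , c)) (σ ∷ʳ true) ≡ dot s (Vec.map (Vec.lookup σ) (vertices e)) xor c
  dot-row (e , refl) s c σ =
    trans (dot-∷ʳ (expand e s) σ c) (cong (_xor c) (sym (dot-expand e s σ)))

  vanishes-row : ∀ e L σ rs →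
    vanishes (List.map (row e) L ++ rs) (σ ∷ʳ true) ≡
    solves L (Vec.map (Vec.lookup σ) (vertices e)) ∧ vanishes rs (σ ∷ʳ true)
  vanishes-row e []            σ rs = refl
  vanishes-row e ((s , c) ∷ L) σ rs rewrite dot-row e s c σ | vanishes-row e L σ rs
    with not (dot s (Vec.map (Vec.lookup σ) (vertices e)) xor c)
  ... | false = refl
  ... | true  = refl

-- A product of indicators is the indicator of the conjunction, so an assignment weighs 1 if it
-- solves every equation of every hyperedge, and 0 otherwise.
Z-solutions : ∀ {k} (f : SymmetricFunction k) L →
  (∀ x → SymmetricFunction.fun f x ≡ ind (solves L x)) → ∀ H →
  Z f H ≡ solutions (rows L (Hypergraph.hyperedges H))
Z-solutions {k} f L affine H = cong sum (Listₚ.map-cong (λ σ → weight σ hyperedges) (assignments order))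
  where
  open SymmetricFunction f
  open Hypergraph H
  weight : ∀ σ (es : List (Hyperedge k order)) →
    product (List.map (λ e → fun (Vec.map (Vec.lookup σ) (vertices e))) es) ≡
    ind (vanishes (rows L es) (σ ∷ʳ true))
  weight σ []       = refl
  weight σ (e ∷ es) rewrite vanishes-row e L σ (rows L es) =
    trans (cong₂ _*_ (affine _) (weight σ es))
          (sym (ind-∧ (solves L (Vec.map (Vec.lookup σ) (vertices e))) _))

-- Tape layout and running-time bookkeeping

open Language 7

cells : ∀ {n} → Vec Bool n → List Sym
cells v = bits (Vec.toList v)

-- In order: the input tape; the output tape; the current equation; the
-- generators; the pivot (also used for the mask of an equation); one scratch
-- bit; a word of length the number of vertices, to measure hyperedges.
⟨_,_,_,_,_,_,_⟩ : ∀ {A : Set} → A → A → A → A → A → A → A → Vec A 7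
⟨ i , o , r , g , p , d , n ⟩ = i ∷ o ∷ r ∷ g ∷ p ∷ d ∷ n ∷ []

ε : CTape
ε = [] ◂ []

one : Bool → CTape
one b = [] ◂ bit b ∷ []

isBit : Sym → Bool
isBit (bit _) = true
isBit _       = false

value : Sym → Bool
value (bit b) = b
value _       = false

inputHead rowHead outHead genHead pivotHead scratchHead rulerHead : Heads → Sym
inputHead   (i ∷ _)                         = i
outHead     (_ ∷ o ∷ _)                     = o
rowHead     (_ ∷ _ ∷ r ∷ _)                 = r
genHead     (_ ∷ _ ∷ _ ∷ g ∷ _)             = g
pivotHead   (_ ∷ _ ∷ _ ∷ _ ∷ p ∷ _)         = p
scratchHead (_ ∷ _ ∷ _ ∷ _ ∷ _ ∷ d ∷ _)     = d
rulerHead   (_ ∷ _ ∷ _ ∷ _ ∷ _ ∷ _ ∷ n ∷ _) = n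

run-≡ : ∀ {p ts ts′ us us′ m m′} → ts ≡ ts′ → us ≡ us′ → m ≡ m′ → Run p ts us m → Run p ts′ us′ m′
run-≡ refl refl refl r = r

loopCost : ℕ → ℕ → ℕ
loopCost c zero    = 1
loopCost c (suc n) = suc (c + loopCost c n)

-- One step back onto the last bit, a test and a move per bit, a last failing test, and one step
-- forward off the blank.
rewindCost : ℕ → ℕ
rewindCost n = 1 + ((n * 2 + 1) + 1)

-- Rewinding a tape, possibly in tandem with others

-- Generators and incidence rows stand on their tapes without separators, so their heads are brought
-- back by a tape whose word ends at a blank. As `tandem` acts once per bit of that word, a
-- companion tape moves left by exactly its length.
rewind : (Heads → Sym) → Commands → Commands → Commands → Program
rewind h back tandem forth =
  perform (const back) ⨾ while (isBit ∘ h) (perform (const tandem)) ⨾ perform (const forth)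

fold-suc : ∀ {S : Set} (f : S → S) s n → fold (f s) f n ≡ f (fold s f n)
fold-suc f s zero    = refl
fold-suc f s (suc n) = cong f (fold-suc f s n)

fold-left : ∀ w {l r} → fold (bits w ʳ++ l ◂ r) (obey (go left)) (length w) ≡ (l ◂ bits w ++ r)
fold-left []      = refl
fold-left (b ∷ w) = cong (obey (go left)) (fold-left w)

module _ {S : Set} (f : S → S) (st : CTape → S → Tapes)
  {h : Heads → Sym} {back tandem forth : Commands}
  (at     : ∀ t s → h (heads (st t s)) ≡ read t)
  (first  : ∀ t s → obeyAll (const back) (st t s) ≡ st (obey (go left) t) s)
  (middle : ∀ t s → obeyAll (const tandem) (st t s) ≡ st (obey (go left) t) (f s))
  (final  : ∀ t s → obeyAll (const forth) (st t s) ≡ st (obey (go right) t) s)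
  where

  private
    loop : ∀ w r s → Run (while (isBit ∘ h) (perform (const tandem)))
      (st (obey (go left) (bits w ◂ r)) s)
      (st ([] ◂ blank ∷′ (bits w ʳ++ r)) (fold s f (length w))) (length w * 2 + 1)
    loop []      r s = run-end (trans (cong isBit (trans (at _ s) (hd-∷′ blank r))) refl)
    loop (b ∷ w) r s = run-≡ refl (cong (st _) (fold-suc f s (length w))) refl
      (run-while (cong isBit (at _ s))
        (run-≡ refl (middle _ s) refl run-perform) (loop w (bit b ∷ r) (f s)))

  -- The state is abstracted to the guiding tape and a companion value `s`, on which `f` is the
  -- effect of one move; one induction thus serves every rewind.
  rewind-tandem : ∀ {n} (v : Vec Bool n) r s →
    Run (rewind h back tandem forth) (st (cells v ʳ++ [] ◂ r) s)
        (st ([] ◂ cells v ++ r) (fold s f n)) (rewindCost n)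
  rewind-tandem {n} v r s = run-≡
    (cong (λ l → st (l ◂ r) s) (Listₚ.map-ʳ++ bit w))
    (trans (final _ _) (cong₂ (λ l m → st l (fold s f m)) ahead
      (trans (Listₚ.length-reverse w) (Vecₚ.length-toList v))))
    (cong (λ m → rewindCost m) (trans (Listₚ.length-reverse w) (Vecₚ.length-toList v)))
    (run-⨾ (run-≡ refl (first _ s) refl run-perform) (run-⨾ (loop (List.reverse w) r s) run-perform))
    where
    w = Vec.toList v
    L = bits (List.reverse w) ʳ++ r
    ahead : obey (go right) ([] ◂ blank ∷′ (bits (List.reverse w) ʳ++ r)) ≡ ([] ◂ bits w ++ r)
    ahead = cong₂ _◂_ (cong (_∷′ []) (hd-∷′ blank L)) (trans (tl-∷′ blank L)
      (trans (cong (_ʳ++ r) (Listₚ.reverse-map bit w))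
        (trans (Listₚ.ʳ++-defn (List.reverse (bits w)))
               (cong (_++ r) (Listₚ.reverse-involutive (bits w))))))

rewind-alone : (st : CTape → Tapes) → ∀ {h back forth}
  (at    : ∀ t → h (heads (st t)) ≡ read t)
  (first : ∀ t → obeyAll (const back) (st t) ≡ st (obey (go left) t))
  (final : ∀ t → obeyAll (const forth) (st t) ≡ st (obey (go right) t)) →
  ∀ {n} (v : Vec Bool n) r →
  Run (rewind h back back forth) (st (cells v ʳ++ [] ◂ r)) (st ([] ◂ cells v ++ r)) (rewindCost n)
rewind-alone st at first final v r =
  rewind-tandem {S = ⊤} (λ _ → tt) (λ t _ → st t) (λ t _ → at t) (λ t _ → first t)
    (λ t _ → first t) (λ t _ → final t) v r tt

rewindOut rewindRow rewindGen rewindPivot rewindRuler rewindRowGen rewindRulerInput : Program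
rewindOut = rewind outHead
  ⟨ keep , go left , keep , keep , keep , keep , keep ⟩
  ⟨ keep , go left , keep , keep , keep , keep , keep ⟩
  ⟨ keep , go right , keep , keep , keep , keep , keep ⟩
rewindRow = rewind rowHead
  ⟨ keep , keep , go left , keep , keep , keep , keep ⟩
  ⟨ keep , keep , go left , keep , keep , keep , keep ⟩
  ⟨ keep , keep , go right , keep , keep , keep , keep ⟩
rewindGen = rewind genHead
  ⟨ keep , keep , keep , go left , keep , keep , keep ⟩
  ⟨ keep , keep , keep , go left , keep , keep , keep ⟩
  ⟨ keep , keep , keep , go right , keep , keep , keep ⟩
rewindPivot = rewind pivotHead
  ⟨ keep , keep , keep , keep , go left , keep , keep ⟩
  ⟨ keep , keep , keep , keep , go left , keep , keep ⟩
  ⟨ keep , keep , keep , keep , go right , keep , keep ⟩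
rewindRuler = rewind rulerHead
  ⟨ keep , keep , keep , keep , keep , keep , go left ⟩
  ⟨ keep , keep , keep , keep , keep , keep , go left ⟩
  ⟨ keep , keep , keep , keep , keep , keep , go right ⟩
rewindRowGen = rewind rowHead
  ⟨ keep , keep , go left , keep , keep , keep , keep ⟩
  ⟨ keep , keep , go left , go left , keep , keep , keep ⟩
  ⟨ keep , keep , go right , keep , keep , keep , keep ⟩
rewindRulerInput = rewind rulerHead
  ⟨ keep , keep , keep , keep , keep , keep , go left ⟩
  ⟨ go left , keep , keep , keep , keep , keep , go left ⟩
  ⟨ keep , keep , keep , keep , keep , keep , go right ⟩

fold-left-cells : ∀ {n} (v : Vec Bool n) {l r} →
  fold (cells v ʳ++ l ◂ r) (obey (go left)) n ≡ (l ◂ cells v ++ r)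
fold-left-cells v {l} {r} =
  trans (cong (fold (cells v ʳ++ l ◂ r) (obey (go left))) (sym (Vecₚ.length-toList v)))
        (fold-left (Vec.toList v))

home : ∀ {m} (v : Vec Bool m) → ([] ◂ cells v ++ []) ≡ ([] ◂ cells v)
home v = cong ([] ◂_) (Listₚ.++-identityʳ (cells v))

run-rewindOut : ∀ {i r g p d n m} (v : Vec Bool m) t → Run rewindOut
  ⟨ i , cells v ʳ++ [] ◂ t , r , g , p , d , n ⟩
  ⟨ i , [] ◂ cells v ++ t , r , g , p , d , n ⟩
  (rewindCost m)
run-rewindOut {i} {r} {g} {p} {d} {n} =
  rewind-alone (λ t → ⟨ i , t , r , g , p , d , n ⟩)
    (λ _ → refl) (λ _ → refl) (λ _ → refl)

run-rewindRow : ∀ {i o g p d n m} (v : Vec Bool m) t → Run rewindRow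
  ⟨ i , o , cells v ʳ++ [] ◂ t , g , p , d , n ⟩
  ⟨ i , o , [] ◂ cells v ++ t , g , p , d , n ⟩
  (rewindCost m)
run-rewindRow {i} {o} {g} {p} {d} {n} =
  rewind-alone (λ t → ⟨ i , o , t , g , p , d , n ⟩)
    (λ _ → refl) (λ _ → refl) (λ _ → refl)

run-rewindGen : ∀ {i o r p d n m} (v : Vec Bool m) t → Run rewindGen
  ⟨ i , o , r , cells v ʳ++ [] ◂ t , p , d , n ⟩
  ⟨ i , o , r , [] ◂ cells v ++ t , p , d , n ⟩
  (rewindCost m)
run-rewindGen {i} {o} {r} {p} {d} {n} =
  rewind-alone (λ t → ⟨ i , o , r , t , p , d , n ⟩)
    (λ _ → refl) (λ _ → refl) (λ _ → refl)

run-rewindPivot : ∀ {i o r g d n m} (v : Vec Bool m) t → Run rewindPivot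
  ⟨ i , o , r , g , cells v ʳ++ [] ◂ t , d , n ⟩
  ⟨ i , o , r , g , [] ◂ cells v ++ t , d , n ⟩
  (rewindCost m)
run-rewindPivot {i} {o} {r} {g} {d} {n} =
  rewind-alone (λ t → ⟨ i , o , r , g , t , d , n ⟩)
    (λ _ → refl) (λ _ → refl) (λ _ → refl)

run-rewindRuler : ∀ {i o r g p d m} (v : Vec Bool m) t → Run rewindRuler
  ⟨ i , o , r , g , p , d , cells v ʳ++ [] ◂ t ⟩
  ⟨ i , o , r , g , p , d , [] ◂ cells v ++ t ⟩
  (rewindCost m)
run-rewindRuler {i} {o} {r} {g} {p} {d} =
  rewind-alone (λ t → ⟨ i , o , r , g , p , d , t ⟩)
    (λ _ → refl) (λ _ → refl) (λ _ → refl)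

run-homeRowGen : ∀ {i o p d n m} (v w : Vec Bool m) {l s} → Run rewindRowGen
  ⟨ i , o , cells v ʳ++ [] ◂ [] , cells w ʳ++ l ◂ s , p , d , n ⟩
  ⟨ i , o , [] ◂ cells v , l ◂ cells w ++ s , p , d , n ⟩ (rewindCost m)
run-homeRowGen {i} {o} {p} {d} {n} v w = run-≡ refl
  (cong₂ (λ t u → ⟨ i , o , t , u , p , d , n ⟩) (home v) (fold-left-cells w)) refl
  (rewind-tandem (obey (go left)) (λ t u → ⟨ i , o , t , u , p , d , n ⟩)
    (λ _ _ → refl) (λ _ _ → refl) (λ _ _ → refl) (λ _ _ → refl) v [] _)

run-homeRulerInput : ∀ {o r g p d m} (v w : Vec Bool m) {l s} → Run rewindRulerInput
  ⟨ cells w ʳ++ l ◂ s , o , r , g , p , d , cells v ʳ++ [] ◂ [] ⟩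
  ⟨ l ◂ cells w ++ s , o , r , g , p , d , [] ◂ cells v ⟩ (rewindCost m)
run-homeRulerInput {o} {r} {g} {p} {d} v w = run-≡ refl
  (cong₂ (λ t u → ⟨ u , o , r , g , p , d , t ⟩) (home v) (fold-left-cells w)) refl
  (rewind-tandem (obey (go left)) (λ t u → ⟨ u , o , r , g , p , d , t ⟩)
    (λ _ _ → refl) (λ _ _ → refl) (λ _ _ → refl) (λ _ _ → refl) v [] _)

run-homeRow : ∀ {i o g p d n m} (v : Vec Bool m) → Run rewindRow
  ⟨ i , o , cells v ʳ++ [] ◂ [] , g , p , d , n ⟩
  ⟨ i , o , [] ◂ cells v , g , p , d , n ⟩
  (rewindCost m)
run-homeRow {i} {o} {g} {p} {d} {n} v =
  run-≡ refl (cong (λ t → ⟨ i , o , t , g , p , d , n ⟩) (home v)) refl (run-rewindRow v [])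

run-homePivot : ∀ {i o r g d n m} (v : Vec Bool m) → Run rewindPivot
  ⟨ i , o , r , g , cells v ʳ++ [] ◂ [] , d , n ⟩
  ⟨ i , o , r , g , [] ◂ cells v , d , n ⟩
  (rewindCost m)
run-homePivot {i} {o} {r} {g} {d} {n} v =
  run-≡ refl (cong (λ t → ⟨ i , o , r , g , t , d , n ⟩) (home v)) refl (run-rewindPivot v [])

run-homeRuler : ∀ {i o r g p d m} (v : Vec Bool m) → Run rewindRuler
  ⟨ i , o , r , g , p , d , cells v ʳ++ [] ◂ [] ⟩
  ⟨ i , o , r , g , p , d , [] ◂ cells v ⟩
  (rewindCost m)
run-homeRuler {i} {o} {r} {g} {p} {d} v =
  run-≡ refl (cong (λ t → ⟨ i , o , r , g , p , d , t ⟩) (home v)) refl (run-rewindRuler v [])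

-- Processing one generator

dotStep : Heads → Commands
dotStep (i ∷ o ∷ r ∷ g ∷ p ∷ d ∷ n ∷ []) =
  ⟨ keep , keep , go right , go right , keep
  , put (bit (value d xor (value r ∧ value g))) stay , keep ⟩

-- A violated equation with no pivot stored is the case of deletion. Blanking the lowest zero of the
-- counter and stepping off it halves the number.
killStep : Heads → Commands
killStep (i ∷ o ∷ r ∷ g ∷ p ∷ d ∷ n ∷ []) =
  ⟨ keep , (if value d ∧ not (isBit p) then put blank right else keep)
  , keep , keep , keep , keep , keep ⟩

-- A blank under the pivot head means that the pivot is still to be written: the generator is then
-- moved to the pivot tape cell by cell, with zeros left behind. The head of that tape stays on a
-- blank all the while, so no extra state is needed.
updateGen updatePivot : Sym → Sym → Sym → Command
updateGen (bit true) (bit p) (bit g) = put (bit (g xor p)) right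
updateGen (bit true) blank   _       = put (bit false) right
updateGen _          _       _       = go right
updatePivot (bit true) (bit p) _ = go right
updatePivot (bit true) blank   g = put g right
updatePivot _          _       _ = keep

updateStep : Heads → Commands
updateStep (i ∷ o ∷ r ∷ g ∷ p ∷ d ∷ n ∷ []) =
  ⟨ keep , keep , go right , updateGen d p g , updatePivot d p g , keep , keep ⟩

clearScratch setScratch : Heads → Commands
clearScratch _ = ⟨ keep , keep , keep , keep , keep , put blank stay , keep ⟩
setScratch   _ = ⟨ keep , keep , keep , keep , keep , put (bit false) stay , keep ⟩

dotProgram updateProgram genProgram : Program
dotProgram    = perform setScratch ⨾ while (isBit ∘ rowHead) (perform dotStep) ⨾ rewindRowGen
updateProgram = perform killStep ⨾ while (isBit ∘ rowHead) (perform updateStep) ⨾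
                rewindRow ⨾ rewindPivot ⨾ perform clearScratch
genProgram    = dotProgram ⨾ updateProgram

pivotCells : ∀ {n} → Row n → List Sym
pivotCells = Maybe.maybe′ cells []

-- A deleted generator stays on the tape as a zero row, which violates no equation.
stored : ∀ {n} → Row n → Vec Bool n
stored = fromMaybe (zeros _)

-- Read as a number, counter l is 2 ^ l; deleting a generator halves it.
counter : ℕ → CTape
counter l = [] ◂ cells (zeros l) ++ bit true ∷ []

countdown : ∀ {n} → Bool → Row n → CTape → CTape
countdown true nothing o = obey (put blank right) o
countdown _    _       o = o

module _ {i o n : CTape} where

  dotLoop : ∀ {p m} (r g : Vec Bool m) rl gl gr b → Run (while (isBit ∘ rowHead) (perform dotStep))
    ⟨ i , o , rl ◂ cells r , gl ◂ cells g ++ gr , p , one b , n ⟩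
    ⟨ i , o , cells r ʳ++ rl ◂ [] , cells g ʳ++ gl ◂ gr , p , one (b xor dot r g) , n ⟩
    (m * 2 + 1)
  dotLoop []      []      rl gl gr false = run-end refl
  dotLoop []      []      rl gl gr true = run-end refl
  dotLoop (a ∷ r) (c ∷ g) rl gl gr b = run-while refl run-perform
    (run-≡ refl
      (cong (λ d → ⟨ i , o , cells r ʳ++ _ ◂ [] , cells g ʳ++ _ ◂ gr , _ , one d , n ⟩)
            (xor-assoc b (a ∧ c) (dot r g)))
      refl (dotLoop r g (bit a ∷ rl) (bit c ∷ gl) gr (b xor (a ∧ c))))

  keepLoop : ∀ {p m} (r g : Vec Bool m) rl gl gr → Run (while (isBit ∘ rowHead) (perform updateStep))
    ⟨ i , o , rl ◂ cells r , gl ◂ cells g ++ gr , p , one false , n ⟩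
    ⟨ i , o , cells r ʳ++ rl ◂ [] , cells g ʳ++ gl ◂ gr , p , one false , n ⟩ (m * 2 + 1)
  keepLoop []      []      rl gl gr = run-end refl
  keepLoop (a ∷ r) (c ∷ g) rl gl gr =
    run-while refl run-perform (keepLoop r g (bit a ∷ rl) (bit c ∷ gl) gr)

  addLoop : ∀ {m} (r g p : Vec Bool m) rl gl gr pl → Run (while (isBit ∘ rowHead) (perform updateStep))
    ⟨ i , o , rl ◂ cells r , gl ◂ cells g ++ gr , pl ◂ cells p , one true , n ⟩
    ⟨ i , o , cells r ʳ++ rl ◂ [] , cells (g ⊕ p) ʳ++ gl ◂ gr , cells p ʳ++ pl ◂ [] , one true , n ⟩
    (m * 2 + 1)
  addLoop []      []      []      rl gl gr pl = run-end refl
  addLoop (a ∷ r) (c ∷ g) (b ∷ p) rl gl gr pl =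
    run-while refl run-perform (addLoop r g p (bit a ∷ rl) (bit (c xor b) ∷ gl) gr (bit b ∷ pl))

  pivotLoop : ∀ {m} (r g : Vec Bool m) rl gl gr pl → Run (while (isBit ∘ rowHead) (perform updateStep))
    ⟨ i , o , rl ◂ cells r , gl ◂ cells g ++ gr , pl ◂ [] , one true , n ⟩
    ⟨ i , o , cells r ʳ++ rl ◂ [] , cells (zeros m) ʳ++ gl ◂ gr , cells g ʳ++ pl ◂ [] , one true , n ⟩
    (m * 2 + 1)
  pivotLoop []      []      rl gl gr pl = run-end refl
  pivotLoop (a ∷ r) (c ∷ g) rl gl gr pl =
    run-while refl run-perform (pivotLoop r g (bit a ∷ rl) (bit false ∷ gl) gr (bit c ∷ pl))

dotCost updateCost genCost : ℕ → ℕ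
dotCost m    = 1 + ((m * 2 + 1) + rewindCost m)
updateCost m = 1 + ((m * 2 + 1) + (rewindCost m + (rewindCost m + 1)))
genCost m    = dotCost m + updateCost m

module _ {i o n : CTape} {m : ℕ} (r g : Vec Bool (suc m)) (gl gr : List Sym) where

  run-dot : ∀ {p} → Run dotProgram
    ⟨ i , o , [] ◂ cells r , gl ◂ cells g ++ gr , p , ε , n ⟩
    ⟨ i , o , [] ◂ cells r , gl ◂ cells g ++ gr , p , one (dot r g) , n ⟩ (dotCost (suc m))
  run-dot = run-⨾ run-perform (run-⨾ (dotLoop r g [] gl gr false) (run-homeRowGen r g))

  run-update : ∀ b q → Run updateProgram
    ⟨ i , o , [] ◂ cells r , gl ◂ cells g ++ gr , [] ◂ pivotCells q , one b , n ⟩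
    ⟨ i , countdown b q o , [] ◂ cells r , cells (stored (nextRow b q g)) ʳ++ gl ◂ gr
    , [] ◂ pivotCells (nextPivot b q g) , ε , n ⟩ (updateCost (suc m))
  run-update false q =
    run-⨾ run-perform (run-⨾ (keepLoop r g [] gl gr) (run-⨾ (run-homeRow r)
      -- The pivot head has not moved, so its rewind is that of the empty word, charged at the full
      -- rate.
      (run-⨾ (run-weaken (s≤s (+-monoˡ-≤ 1 (+-monoˡ-≤ 1 {0} {suc m * 2} z≤n)))
        (run-rewindPivot [] (pivotCells q))) run-perform)))
  run-update true nothing =
    run-⨾ run-perform (run-⨾ (pivotLoop r g [] gl gr []) (run-⨾ (run-homeRow r)
      (run-⨾ (run-homePivot g) run-perform)))
  -- Exposing the first bit of the pivot lets `killStep` see that a pivot exists and spare the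
  -- counter.
  run-update true (just p@(_ ∷ _)) =
    run-⨾ run-perform (run-⨾ (addLoop r g p [] gl gr []) (run-⨾ (run-homeRow r)
      (run-⨾ (run-homePivot p) run-perform)))

  run-gen : ∀ q → Run genProgram
    ⟨ i , o , [] ◂ cells r , gl ◂ cells g ++ gr , [] ◂ pivotCells q , ε , n ⟩
    ⟨ i , countdown (dot r g) q o , [] ◂ cells r , cells (stored (nextRow (dot r g) q g)) ʳ++ gl ◂ gr
    , [] ◂ pivotCells (nextPivot (dot r g) q g) , ε , n ⟩ (genCost (suc m))
  run-gen q = run-⨾ run-dot (run-update (dot r g) q)

-- Passing an equation through all generators

flat : ∀ {n} → List (Row n) → List Bool
flat []       = []
flat (g ∷ gs) = Vec.toList (stored g) ++ flat gs

length-flat : ∀ {n} (gs : List (Row n)) → length (flat gs) ≡ length gs * n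
length-flat []       = refl
length-flat (g ∷ gs) = trans (Listₚ.length-++ (Vec.toList (stored g)))
  (cong₂ _+_ (Vecₚ.length-toList (stored g)) (length-flat gs))

flat-ahead : ∀ {n} (g : Row n) gs → bits (flat (g ∷ gs)) ≡ cells (stored g) ++ bits (flat gs)
flat-ahead g gs = Listₚ.map-++ bit (Vec.toList (stored g)) (flat gs)

flat-behind : ∀ {n} (g : Row n) gs l →
  bits (flat (g ∷ gs)) ʳ++ l ≡ bits (flat gs) ʳ++ (cells (stored g) ʳ++ l)
flat-behind g gs l = trans (cong (_ʳ++ l) (flat-ahead g gs)) (Listₚ.++-ʳ++ (cells (stored g)))

length-pass : ∀ {n} q (r : Vec Bool n) gs → length (pass q r gs) ≡ length gs
length-pass q r []             = refl
length-pass q r (nothing ∷ gs) = cong suc (length-pass q r gs)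
length-pass q r (just g  ∷ gs) = cong suc (length-pass _ r gs)

run-homeGen : ∀ {i o r p d n} (w : List Bool) → Run rewindGen
  ⟨ i , o , r , bits w ʳ++ [] ◂ [] , p , d , n ⟩ ⟨ i , o , r , [] ◂ bits w , p , d , n ⟩
  (rewindCost (length w))
run-homeGen {i} {o} {r} {p} {d} {n} w = run-≡
  (cong (λ v → ⟨ i , o , r , bits v ʳ++ [] ◂ [] , p , d , n ⟩) (Vecₚ.toList∘fromList w))
  (cong (λ t → ⟨ i , o , r , t , p , d , n ⟩)
    (trans (home (Vec.fromList w)) (cong (λ v → [] ◂ bits v) (Vecₚ.toList∘fromList w)))) refl
  (run-rewindGen (Vec.fromList w) [])

erasePivot : Heads → Commands
erasePivot _ = ⟨ keep , keep , keep , keep , put blank right , keep , keep ⟩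

passProgram : Program
passProgram = rewindGen ⨾ while (isBit ∘ genHead) genProgram ⨾
              while (isBit ∘ pivotHead) (perform erasePivot)

passCost : ℕ → ℕ → ℕ
passCost m l = rewindCost (l * m) + (loopCost (genCost m) l + (m * 2 + 1))

isBit-cells : ∀ {m} (v : Vec Bool (suc m)) l → isBit (hd (cells v ++ l)) ≡ true
isBit-cells (_ ∷ _) l = refl

module _ {i n : CTape} where

  eraseLoop : ∀ {o r g d m} (p : Vec Bool m) → Run (while (isBit ∘ pivotHead) (perform erasePivot))
    ⟨ i , o , r , g , [] ◂ cells p , d , n ⟩ ⟨ i , o , r , g , ε , d , n ⟩ (m * 2 + 1)
  eraseLoop []      = run-end refl
  eraseLoop (_ ∷ p) = run-while refl run-perform (eraseLoop p)

  run-erase : ∀ {o r g d m} (q : Row m) → Run (while (isBit ∘ pivotHead) (perform erasePivot))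
    ⟨ i , o , r , g , [] ◂ pivotCells q , d , n ⟩ ⟨ i , o , r , g , ε , d , n ⟩ (m * 2 + 1)
  run-erase nothing  = run-weaken (m≤n+m 1 _) (run-end refl)
  run-erase (just p) = eraseLoop p

  module _ {m : ℕ} (r : Vec Bool (suc m)) where

    passState : CTape → CTape → Row (suc m) → Tapes
    passState o g q = ⟨ i , o , [] ◂ cells r , g , [] ◂ pivotCells q , ε , n ⟩

    advance : ∀ b g → dot r g ≡ b → ∀ q o gl gr → Run genProgram
      (passState o (gl ◂ cells g ++ gr) q)
      (passState (countdown b q o) (cells (stored (nextRow b q g)) ʳ++ gl ◂ gr) (nextPivot b q g))
      (genCost (suc m))
    advance _ g refl q o gl gr = run-gen r g gl gr q

    -- One iteration for all cases of the sweep: `h` is the generator read and `g` the one left in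
    -- its place. The machine treats a deleted `h` as a zero row, so only the stored vectors are
    -- compared.
    advances : ∀ b (g h : Row (suc m)) gs gs′ q q′ {o o′ gl c} → dot r (stored h) ≡ b →
      stored g ≡ stored (nextRow b q (stored h)) →
      Run (while (isBit ∘ genHead) genProgram)
        (passState (countdown b q o) (cells (stored g) ʳ++ gl ◂ bits (flat gs)) (nextPivot b q (stored h)))
        (passState o′ (bits (flat gs′) ʳ++ (cells (stored g) ʳ++ gl) ◂ []) q′) c →
      Run (while (isBit ∘ genHead) genProgram)
        (passState o (gl ◂ bits (flat (h ∷ gs))) q)
        (passState o′ (bits (flat (g ∷ gs′)) ʳ++ gl ◂ []) q′) (suc (genCost (suc m) + c))
    advances b g h gs gs′ q q′ {o} {o′} {gl} e e′ x = run-≡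
      (cong (λ t → passState o (gl ◂ t) q) (sym (flat-ahead h gs)))
      (cong (λ t → passState o′ (t ◂ []) q′) (sym (flat-behind g gs′ gl))) refl
      (run-while (isBit-cells (stored h) _)
        (subst (λ v → Run genProgram _
                 (passState (countdown b q o) (cells v ʳ++ gl ◂ _) (nextPivot b q (stored h))) _)
               (sym e′) (advance b (stored h) e q o gl _)) x)

    -- `l` counts the surviving generators already behind the head, since the counter refers to the
    -- whole list and `gs` only to what lies ahead.
    passLoop : ∀ gs q l gl → ∃[ q′ ] Run (while (isBit ∘ genHead) genProgram)
      (passState (counter (live gs + l)) (gl ◂ bits (flat gs)) q)
      (passState (counter (live (pass q r gs) + l)) (bits (flat (pass q r gs)) ʳ++ gl ◂ []) q′)
      (loopCost (genCost (suc m)) (length gs))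
    passLoop [] q l gl = q , run-end refl
    passLoop (nothing ∷ gs) q l gl
      with q′ , x ← passLoop gs q l (cells (zeros (suc m)) ʳ++ gl)
      = q′ , advances false nothing nothing gs (pass q r gs) q q′ (dot-zeroʳ r) refl x
    passLoop (just g ∷ gs) q l gl with dot r g in e
    passLoop (just g ∷ gs) q l gl | false
      with q′ , x ← passLoop gs q (suc l) (cells g ʳ++ gl)
      = q′ , run-≡
        (cong (λ k → passState (counter k) (gl ◂ bits (flat (just g ∷ gs))) q) (+-suc (live gs) l))
        (cong (λ k → passState (counter k) (bits (flat (just g ∷ pass q r gs)) ʳ++ gl ◂ []) q′)
              (+-suc (live (pass q r gs)) l)) refl
        (advances false (just g) (just g) gs (pass q r gs) q q′ e refl x)
    passLoop (just g ∷ gs) nothing l gl | true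
      with q′ , x ← passLoop gs (just g) l (cells (zeros (suc m)) ʳ++ gl)
      = q′ , advances true nothing (just g) gs (pass (just g) r gs) nothing q′ e refl x
    passLoop (just g ∷ gs) (just p) l gl | true
      with q′ , x ← passLoop gs (just p) (suc l) (cells (g ⊕ p) ʳ++ gl)
      = q′ , run-≡
        (cong (λ k → passState (counter k) (gl ◂ bits (flat (just g ∷ gs))) (just p)) (+-suc (live gs) l))
        (cong (λ k → passState (counter k) (bits (flat (just (g ⊕ p) ∷ pass (just p) r gs)) ʳ++ gl ◂ []) q′)
              (+-suc (live (pass (just p) r gs)) l)) refl
        (advances true (just (g ⊕ p)) (just g) gs (pass (just p) r gs) (just p) q′ e refl x)

    run-pass : ∀ gs → Run passProgram
      (passState (counter (live gs)) (bits (flat gs) ʳ++ [] ◂ []) nothing)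
      (passState (counter (live (pass nothing r gs))) (bits (flat (pass nothing r gs)) ʳ++ [] ◂ []) nothing)
      (passCost (suc m) (length gs))
    run-pass gs with q′ , x ← passLoop gs nothing 0 [] =
      run-⨾ (run-≡ refl refl (cong rewindCost (length-flat gs)) (run-homeGen (flat gs)))
        (run-⨾ (run-≡
          (cong (λ k → passState (counter k) ([] ◂ bits (flat gs)) nothing) (+-identityʳ (live gs)))
          (cong (λ k → passState (counter k) (bits (flat gs′) ʳ++ [] ◂ []) q′) (+-identityʳ (live gs′)))
          refl x) (run-erase q′))
      where gs′ = pass nothing r gs

-- Reading the equations of a hyperedge

pushMask : Bool → Heads → Commands
pushMask b _ = ⟨ keep , keep , keep , keep , put (bit b) left , keep , keep ⟩

mountMask : Heads → Commands
mountMask _ = ⟨ keep , keep , keep , keep , go right , keep , keep ⟩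

-- The coefficients are hard-wired into the states, which works because the equations depend on the
-- function and not on the hypergraph. Writing from the last to the first leaves the head just
-- before the mask.
writeMask : ∀ {k} → Vec Bool k → Program
writeMask []      = perform (const idle)
writeMask (b ∷ s) = writeMask s ⨾ perform (pushMask b)

-- Each member of the hyperedge consumes one coefficient of the mask, which is erased on the way;
-- the pivot tape is therefore empty again when the sweep over the generators begins. The ruler
-- marks the end of the incidence row.
expandStep : Heads → Commands
expandStep (i ∷ o ∷ r ∷ g ∷ p ∷ d ∷ n ∷ []) =
  ⟨ go right , keep , put (bit (value i ∧ value p)) right , keep
  , (if value i then put blank right else keep) , keep , go right ⟩

writeConstant : Bool → Heads → Commands
writeConstant c _ = ⟨ keep , keep , put (bit c) stay , keep , keep , keep , keep ⟩

skipStep : Heads → Commands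
skipStep _ = ⟨ go right , keep , keep , keep , keep , keep , go right ⟩

equationProgram : ∀ {k} → Equation k → Program
equationProgram (s , c) =
  writeMask s ⨾ perform mountMask ⨾ while (isBit ∘ rulerHead) (perform expandStep) ⨾
  perform (writeConstant c) ⨾ rewindRow ⨾ rewindRulerInput ⨾ passProgram

-- Each equation puts the input head back at the start of the incidence row, to be read again for
-- the next one; the row is passed over once all equations are done.
hyperedgeProgram : ∀ {k} → List (Equation k) → Program
hyperedgeProgram []      = while (isBit ∘ rulerHead) (perform skipStep) ⨾ rewindRuler
hyperedgeProgram (q ∷ L) = equationProgram q ⨾ hyperedgeProgram L

module _ {o g d : CTape} where

  run-writeMask : ∀ {i r n k} (s : Vec Bool k) → Run (writeMask s)
    ⟨ i , o , r , g , ε , d , n ⟩ ⟨ i , o , r , g , [] ◂ blank ∷′ cells s , d , n ⟩ (suc k)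
  run-writeMask []      = run-perform
  run-writeMask {i} {r} {n} (b ∷ s) = run-≡ refl
    (cong (λ l → ⟨ i , o , r , g , [] ◂ blank ∷ bit b ∷ l , d , n ⟩) (tl-∷′ blank (cells s)))
    (+-comm _ 1) (run-⨾ (run-writeMask s) run-perform)

  run-mountMask : ∀ {i r n k} (s : Vec Bool k) → Run (perform mountMask)
    ⟨ i , o , r , g , [] ◂ blank ∷′ cells s , d , n ⟩ ⟨ i , o , r , g , [] ◂ cells s , d , n ⟩ 1
  run-mountMask []      = run-perform
  run-mountMask (_ ∷ _) = run-perform

  expandLoop : ∀ {m} (e : Subset m) (s : Vec Bool ∣ e ∣) (w u : Vec Bool m) il i rl r nl →
    Run (while (isBit ∘ rulerHead) (perform expandStep))
    ⟨ il ◂ cells e ++ i , o , rl ◂ cells w ++ r , g , [] ◂ cells s , d , nl ◂ cells u ⟩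
    ⟨ cells e ʳ++ il ◂ i , o , cells (expand e s) ʳ++ rl ◂ r , g , ε , d , cells u ʳ++ nl ◂ [] ⟩
    (m * 2 + 1)
  expandLoop []            []      []      []      il i rl r nl = run-end refl
  expandLoop (inside  ∷ e) (b ∷ s) (a ∷ w) (c ∷ u) il i rl r nl =
    run-while refl run-perform
      (expandLoop e s w u (bit true ∷ il) i (bit b ∷ rl) r (bit c ∷ nl))
  expandLoop (outside ∷ e) s       (a ∷ w) (c ∷ u) il i rl r nl =
    run-while refl run-perform
      (expandLoop e s w u (bit false ∷ il) i (bit false ∷ rl) r (bit c ∷ nl))

  skipLoop : ∀ {r p m} (e u : Vec Bool m) il i nl → Run (while (isBit ∘ rulerHead) (perform skipStep))
    ⟨ il ◂ cells e ++ i , o , r , g , p , d , nl ◂ cells u ⟩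
    ⟨ cells e ʳ++ il ◂ i , o , r , g , p , d , cells u ʳ++ nl ◂ [] ⟩ (m * 2 + 1)
  skipLoop []      []      il i nl = run-end refl
  skipLoop (a ∷ e) (c ∷ u) il i nl =
    run-while refl run-perform (skipLoop e u (bit a ∷ il) i (bit c ∷ nl))

equationCost : ℕ → ℕ → ℕ → ℕ
equationCost k n l = suc k + (1 + ((n * 2 + 1) + (1 +
  (rewindCost (suc n) + (rewindCost n + passCost (suc n) l)))))

hyperedgeCost : ℕ → ℕ → ℕ → ℕ → ℕ
hyperedgeCost k n l zero    = (n * 2 + 1) + rewindCost n
hyperedgeCost k n l (suc q) = equationCost k n l + hyperedgeCost k n l q

mainState : ∀ {n} → CTape → Vec Bool (suc n) → List (Row (suc n)) → Tapes
mainState {n} i r gs =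
  ⟨ i , counter (live gs) , [] ◂ cells r , bits (flat gs) ʳ++ [] ◂ [] , ε , ε , [] ◂ cells (zeros n) ⟩

cells-∷ʳ : ∀ {m} (v : Vec Bool m) c → cells (v ∷ʳ c) ≡ cells v ++ bit c ∷ []
cells-∷ʳ v c = trans (cong bits (Vecₚ.toList-∷ʳ c v)) (Listₚ.map-++ bit (Vec.toList v) _)

module _ {k n : ℕ} where

  run-equation : ∀ (e : Hyperedge k n) s c il i r gs → Run (equationProgram (s , c))
    (mainState (il ◂ cells (proj₁ e) ++ i) r gs)
    (mainState (il ◂ cells (proj₁ e) ++ i) (row e (s , c)) (pass nothing (row e (s , c)) gs))
    (equationCost k n (length gs))
  -- The previous equation is overwritten in place. Its constant is split off because the expansion
  -- loop covers only the first `n` cells.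
  run-equation (e , refl) s c il i r gs with w , x , refl ← Vec.initLast r =
    run-⨾ (run-writeMask s) (run-⨾ (run-mountMask s)
      (run-⨾ (run-≡ (cong (λ t → ⟨ I , O , [] ◂ t , G , [] ◂ cells s , ε , [] ◂ cells (zeros n) ⟩)
                          (sym (cells-∷ʳ w x))) refl refl
               (expandLoop e s w (zeros n) il i [] (bit x ∷ []) []))
        (run-⨾ run-perform
          -- The head still stands on the constant, so only `n` cells lie behind it, while the bound
          -- charges for `suc n`.
          (run-⨾ (run-weaken (+-monoʳ-≤ 1 (+-monoˡ-≤ 1 (+-monoˡ-≤ 1 (m≤n+m (n * 2) 2))))
                   (run-≡ refl
                     (cong (λ t → ⟨ cells e ʳ++ il ◂ i , O , [] ◂ t , G , ε , ε , cells (zeros n) ʳ++ [] ◂ [] ⟩)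
                           (sym (cells-∷ʳ (expand e s) c))) refl
                     (run-rewindRow (expand e s) (bit c ∷ []))))
            (run-⨾ (run-homeRulerInput (zeros n) e) (run-pass (expand e s ∷ʳ c) gs))))))
    where
    I = il ◂ cells e ++ i
    O = counter (live gs)
    G = bits (flat gs) ʳ++ [] ◂ []

  run-hyperedge : ∀ (e : Hyperedge k n) L il i r gs → ∃[ r′ ] Run (hyperedgeProgram L)
    (mainState (il ◂ cells (proj₁ e) ++ i) r gs)
    (mainState (cells (proj₁ e) ʳ++ il ◂ i) r′ (eliminate gs (List.map (row e) L)))
    (hyperedgeCost k n (length gs) (length L))
  run-hyperedge e [] il i r gs = r ,
    run-⨾ (skipLoop (proj₁ e) (zeros n) il i []) (run-homeRuler (zeros n))
  run-hyperedge e (q@(s , c) ∷ L) il i r gs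
    with r′ , x ← run-hyperedge e L il i (row e q) (pass nothing (row e q) gs)
    = r′ , run-⨾ (run-equation e s c il i r gs)
             (run-≡ refl refl (cong (λ l → hyperedgeCost k n l (length L)) (length-pass nothing (row e q) gs)) x)

-- The loop over all hyperedges

mainProgram : ∀ {k} → List (Equation k) → Program
mainProgram L = while (isBit ∘ inputHead) (hyperedgeProgram L)

mainCost : ℕ → ℕ → ℕ → ℕ → ℕ
mainCost k n q m = loopCost (hyperedgeCost k n (suc n) q) m

length-eliminate : ∀ {n} (gs : List (Row n)) rs → length (eliminate gs rs) ≡ length gs
length-eliminate gs []       = refl
length-eliminate gs (r ∷ rs) =
  trans (length-eliminate (pass nothing r gs) rs) (length-pass nothing r gs)

-- The main loop stops at the first blank of the input. A hyperedge with a member forces a vertex,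
-- so its incidence row is nonempty and is noticed.
isBit-hyperedge : ∀ {k n} → 2 ≤ k → (e : Hyperedge k n) → ∀ l →
                  isBit (hd (cells (proj₁ e) ++ l)) ≡ true
isBit-hyperedge () ([] , refl) l
isBit-hyperedge _  (_ ∷ _ , _) l = refl

run-main : ∀ {k n} → 2 ≤ k → ∀ L (es : List (Hyperedge k n)) il r gs → length gs ≡ suc n →
  ∃[ il′ ] ∃[ r′ ] Run (mainProgram L)
    (mainState (il ◂ bits (List.concatMap (λ e → Vec.toList (proj₁ e)) es)) r gs)
    (mainState (il′ ◂ []) r′ (eliminate gs (rows L es)))
    (mainCost k n (length L) (length es))
run-main 2≤k L []       il r gs _ = il , r , run-end refl
run-main {k} {n} 2≤k L (e ∷ es) il r gs ∣gs∣
  with r₁ , x ← run-hyperedge e L il (bits (List.concatMap (λ e → Vec.toList (proj₁ e)) es)) r gs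
  with il′ , r′ , y ← run-main 2≤k L es (cells (proj₁ e) ʳ++ il) r₁ (eliminate gs (List.map (row e) L))
                        (trans (length-eliminate gs (List.map (row e) L)) ∣gs∣)
  = il′ , r′ , run-≡
    (cong (λ t → mainState (il ◂ t) r gs) (sym (Listₚ.map-++ bit (Vec.toList (proj₁ e)) _)))
    (cong (mainState (il′ ◂ []) r′) (sym (Listₚ.foldl-++ _ gs (List.map (row e) L) _)))
    (cong (λ l → suc (hyperedgeCost k n l (length L) + mainCost k n (length L) (length es))) ∣gs∣)
    (run-while (isBit-hyperedge 2≤k e _) x y)

-- Initialisation: the generators are the unit vectors

-- The cells written by `startStep` account for the appended coordinate: the counter gets `suc n`
-- zeros and the first unit vector has length `suc n`, while the ruler keeps length `n`.
startStep countStep topStep buildStep : Heads → Commands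
startStep _ = ⟨ keep , put (bit false) right , put (bit true) right , keep , keep , put (bit false) stay , keep ⟩
countStep _ =
  ⟨ go right , put (bit false) right , put (bit false) right , keep , keep , keep , put (bit false) right ⟩
topStep _ = ⟨ go right , put (bit true) stay , keep , keep , keep , keep , keep ⟩
-- Copies the current unit vector to the generators and shifts it by one place;
-- the scratch bit carries the symbol to be shifted.
buildStep (i ∷ o ∷ r ∷ g ∷ p ∷ d ∷ n ∷ []) =
  ⟨ keep , keep , put d right , put r right , keep , put r stay , keep ⟩

-- Shifting the last unit vector carries its 1 out into the scratch bit, and this ends the outer
-- loop of `buildProgram`.
buildProgram initProgram : Program
buildProgram = while (not ∘ value ∘ scratchHead)
  (while (isBit ∘ rowHead) (perform buildStep) ⨾ rewindRow)
initProgram =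
  perform startStep ⨾ while (value ∘ inputHead) (perform countStep) ⨾ perform topStep ⨾
  rewindOut ⨾ rewindRow ⨾ rewindRuler ⨾ buildProgram ⨾ perform clearScratch

shift : ∀ {m} → Bool → Vec Bool m → Vec Bool m
shift b []      = []
shift b (a ∷ v) = b ∷ shift a v

carry : ∀ {m} → Bool → Vec Bool m → Bool
carry b []      = b
carry b (a ∷ v) = carry a v

shifts : ∀ {m} → ℕ → Vec Bool m → List (Vec Bool m)
shifts zero    v = v ∷ []
shifts (suc j) v = v ∷ shifts j (shift false v)

-- The index is the number of places after the 1, hence of shifts that carry out nothing.
data OneHot : ∀ {m} → Vec Bool m → ℕ → Set where
  here  : ∀ {j} → OneHot (true ∷ zeros j) j
  there : ∀ {m j} {v : Vec Bool m} → OneHot v j → OneHot (false ∷ v) j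

carry-zeros : ∀ b m → carry b (zeros (suc m)) ≡ false
carry-zeros b zero    = refl
carry-zeros b (suc m) = carry-zeros false m

shift-zeros : ∀ m → shift false (zeros m) ≡ zeros m
shift-zeros zero    = refl
shift-zeros (suc m) = cong (false ∷_) (shift-zeros m)

carry-last : ∀ {m} {v : Vec Bool m} → OneHot v 0 → carry false v ≡ true
carry-last here      = refl
carry-last (there h) = carry-last h

carry-inner : ∀ {m j} {v : Vec Bool m} → OneHot v (suc j) → carry false v ≡ false
carry-inner (here {suc j}) = carry-zeros true j
carry-inner (there h)      = carry-inner h

shift-oneHot : ∀ {m j} {v : Vec Bool m} → OneHot v (suc j) → OneHot (shift false v) j
shift-oneHot (here {suc j}) rewrite shift-zeros j = there here
shift-oneHot (there h)      = there (shift-oneHot h)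

shifts-false∷ : ∀ {m} j (v : Vec Bool m) → shifts j (false ∷ v) ≡ List.map (false ∷_) (shifts j v)
shifts-false∷ zero    v = refl
shifts-false∷ (suc j) v = cong ((false ∷ v) ∷_) (shifts-false∷ j (shift false v))

shifts-units : ∀ n → shifts n (true ∷ zeros n) ≡ units (suc n)
shifts-units zero    = refl
shifts-units (suc n) = cong ((true ∷ zeros (suc n)) ∷_) (begin
  shifts n (false ∷ true ∷ shift false (zeros n))
    ≡⟨ cong (λ v → shifts n (false ∷ true ∷ v)) (shift-zeros n) ⟩
  shifts n (false ∷ true ∷ zeros n)
    ≡⟨ shifts-false∷ n (true ∷ zeros n) ⟩
  List.map (false ∷_) (shifts n (true ∷ zeros n))
    ≡⟨ cong (List.map (false ∷_)) (shifts-units n) ⟩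
  List.map (false ∷_) (units (suc n)) ∎)
  where open ≡-Reasoning

buildCost initCost : ℕ → ℕ
buildCost n = loopCost ((suc n * 2 + 1) + rewindCost (suc n)) (suc n)
initCost n  = 1 + ((n * 2 + 1) + (1 + (rewindCost (suc n) + (rewindCost (suc n) +
  (rewindCost n + (buildCost n + 1))))))

module _ {i o p n : CTape} where

  shiftLoop : ∀ {m} (v : Vec Bool m) rl gl b → Run (while (isBit ∘ rowHead) (perform buildStep))
    ⟨ i , o , rl ◂ cells v , gl ◂ [] , p , one b , n ⟩
    ⟨ i , o , cells (shift b v) ʳ++ rl ◂ [] , cells v ʳ++ gl ◂ [] , p , one (carry b v) , n ⟩ (m * 2 + 1)
  shiftLoop []      rl gl b = run-end refl
  shiftLoop (a ∷ v) rl gl b = run-while refl run-perform (shiftLoop v (bit b ∷ rl) (bit a ∷ gl) a)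

  run-shift : ∀ {m} (v : Vec Bool m) gl c → carry false v ≡ c →
    Run (while (isBit ∘ rowHead) (perform buildStep) ⨾ rewindRow)
    ⟨ i , o , [] ◂ cells v , gl ◂ [] , p , one false , n ⟩
    ⟨ i , o , [] ◂ cells (shift false v) , cells v ʳ++ gl ◂ [] , p , one c , n ⟩
    ((m * 2 + 1) + rewindCost m)
  run-shift v gl _ refl = run-⨾ (shiftLoop v [] gl false) (run-homeRow (shift false v))

  run-build : ∀ {m} j (v : Vec Bool m) → OneHot v j → ∀ gl → ∃[ v′ ] Run buildProgram
    ⟨ i , o , [] ◂ cells v , gl ◂ [] , p , one false , n ⟩
    ⟨ i , o , [] ◂ cells {m} v′ , bits (flat (List.map just (shifts j v))) ʳ++ gl ◂ [] , p , one true , n ⟩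
    (loopCost ((m * 2 + 1) + rewindCost m) (suc j))
  run-build zero v h gl = shift false v ,
    run-≡ refl (cong (λ t → ⟨ i , o , [] ◂ cells (shift false v) , t ◂ [] , p , one true , n ⟩)
                     (sym (flat-behind (just v) [] gl))) refl
      (run-while refl (run-shift v gl true (carry-last h)) (run-end refl))
  run-build (suc j) v h gl
    with v′ , x ← run-build j (shift false v) (shift-oneHot h) (cells v ʳ++ gl)
    = v′ , run-≡ refl (cong (λ t → ⟨ i , o , [] ◂ cells v′ , t ◂ [] , p , one true , n ⟩)
                     (sym (flat-behind (just v) (List.map just (shifts j (shift false v))) gl))) refl
      (run-while refl (run-shift v gl false (carry-inner h)) x)

countLoop : ∀ m w il ol rl nl {g p d} → Run (while (value ∘ inputHead) (perform countStep))
  ⟨ il ◂ bits (List.replicate m true ++ false ∷ w) , ol ◂ [] , rl ◂ [] , g , p , d , nl ◂ [] ⟩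
  ⟨ bits (List.replicate m true) ʳ++ il ◂ bits (false ∷ w) , cells (zeros m) ʳ++ ol ◂ []
  , cells (zeros m) ʳ++ rl ◂ [] , g , p , d , cells (zeros m) ʳ++ nl ◂ [] ⟩ (m * 2 + 1)
countLoop zero    w il ol rl nl = run-end refl
countLoop (suc m) w il ol rl nl = run-while refl run-perform
  (countLoop m w (bit true ∷ il) (bit false ∷ ol) (bit false ∷ rl) (bit false ∷ nl))

live-just : ∀ {n} (gs : List (Vec Bool n)) → live (List.map just gs) ≡ length gs
live-just []       = refl
live-just (g ∷ gs) = cong suc (live-just gs)

length-units : ∀ n → length (units n) ≡ n
length-units zero    = refl
length-units (suc n) = cong suc (trans (Listₚ.length-map _ (units n)) (length-units n))

generators : ∀ n → List (Row (suc n))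
generators n = List.map just (units (suc n))

run-init : ∀ n w → ∃[ il ] ∃[ r ] Run initProgram
  ⟨ [] ◂ bits (List.replicate n true ++ false ∷ w) , ε , ε , ε , ε , ε , ε ⟩
  (mainState (il ◂ bits w) r (generators n)) (initCost n)
run-init n w
  with r , x ← run-build n (true ∷ zeros n) here []
  = _ , r ,
  run-⨾ run-perform
  (run-⨾ (countLoop n w [] (bit false ∷ []) (bit true ∷ []) [])
  (run-⨾ run-perform
  (run-⨾ (run-≡ refl
           (cong (λ l → ⟨ I , counter l , R , ε , ε , one false , N ⟩)
             (sym (trans (live-just (units (suc n))) (length-units (suc n))))) refl
           (run-rewindOut (zeros (suc n)) (bit true ∷ [])))
  (run-⨾ (run-homeRow (true ∷ zeros n))
  (run-⨾ (run-homeRuler (zeros n))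
  (run-⨾ (run-≡ refl
           (cong (λ gs → ⟨ I , O , [] ◂ cells r , bits (flat (List.map just gs)) ʳ++ [] ◂ []
                         , ε , one true , [] ◂ cells (zeros n) ⟩)
             (shifts-units n)) refl x)
    run-perform))))))
  where
  I = bit false ∷ bits (List.replicate n true) ʳ++ [] ◂ bits w
  O = counter (live (generators n))
  R = cells (true ∷ zeros n) ʳ++ [] ◂ []
  N = cells (zeros n) ʳ++ [] ◂ []

-- The verdict: the system is solvable if and only if the point is still present

stepBack verdict : Heads → Commands
stepBack _ = ⟨ keep , keep , keep , go left , keep , keep , keep ⟩
verdict (i ∷ o ∷ r ∷ g ∷ p ∷ d ∷ n ∷ []) =
  ⟨ keep , put blank (if value g then right else stay) , keep , keep , keep , keep , keep ⟩

last-cells : ∀ {m} (v : Vec Bool (suc m)) l → value (hd (cells v ʳ++ l)) ≡ Vec.last v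
last-cells (_ ∷ [])        l = refl
last-cells (a ∷ v@(_ ∷ _)) l = last-cells v (bit a ∷ l)

-- The last cell of the generator tape is the final coordinate of the last generator; a deleted
-- point is stored as zeros and so shows 0 there.
last-flat : ∀ {n} {gs : List (Row (suc n))} {b} → Shaped gs b → ∀ l →
            value (hd (bits (flat gs) ʳ++ l)) ≡ b
last-flat {n} dead l = trans (cong (value ∘ hd) (flat-behind {suc n} nothing [] l))
  (trans (last-cells (zeros (suc n)) l) (last-zeros n))
last-flat (alive {p} e) l = trans (cong (value ∘ hd) (flat-behind (just p) [] l))
  (trans (last-cells p l) e)
last-flat (deleted {gs} s) l =
  trans (cong (value ∘ hd) (flat-behind nothing gs l)) (last-flat s _)
last-flat (direction {g} {gs} _ s) l =
  trans (cong (value ∘ hd) (flat-behind (just g) gs l)) (last-flat s _)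

binaryValue-power : ∀ l → binaryValue (leadingBits (cells (zeros l) ++ bit true ∷ [])) ≡ 2 ^ l
binaryValue-power zero    = refl
binaryValue-power (suc l) = cong (2 *_) (binaryValue-power l)

leadingBits-blank∷′ : ∀ l → leadingBits (blank ∷′ l) ≡ []
leadingBits-blank∷′ []      = refl
leadingBits-blank∷′ (_ ∷ _) = refl

-- The counter includes the point, whose coefficient is not free, so one more halving yields the
-- count. Without the point, a blank left under the head makes the output empty, which reads as 0.
verdict-value : ∀ {n} {gs : List (Row (suc n))} {b} → Shaped gs b →
  binaryValue (leadingBits (CTape.ahead
    (obey (put blank (if value (hd (hd (bits (flat gs) ʳ++ []) ∷′ [])) then right else stay))
          (counter (live gs)))))
  ≡ (if b then 2 ^ pred (live gs) else 0)
verdict-value {gs = gs} {b} s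
  rewrite hd-∷′ (hd (bits (flat gs) ʳ++ [])) [] | last-flat s [] with b
... | true  rewrite live-shaped s = binaryValue-power (pred (live gs))
... | false = cong binaryValue (leadingBits-blank∷′ (tl (CTape.ahead (counter (live gs)))))

-- The complete counting program

counting : ∀ {k} → List (Equation k) → Program
counting L = initProgram ⨾ mainProgram L ⨾ perform stepBack ⨾ perform verdict

countingCost : ℕ → ℕ → ℕ → ℕ → ℕ
countingCost k q n m = initCost n + (mainCost k n q m + 2)

module _ {k : ℕ} (2≤k : 2 ≤ k) (L : List (Equation k)) (H : Hypergraph k) where
  open Hypergraph H

  run-counting : ∃[ ts ]
    Run (counting L) (([] ◂ bits (encodeHypergraph H)) ∷ Vec.replicate 6 ε) ts
        (countingCost k (length L) order (length hyperedges)) ×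
    binaryValue (leadingBits (CTape.ahead (Vec.lookup ts (Fin.suc Fin.zero)))) ≡
    solutions (rows L hyperedges)
  run-counting
    with il  , r  , x ← run-init order (List.concatMap (λ e → Vec.toList (proj₁ e)) hyperedges)
    with il′ , r′ , y ← run-main 2≤k L hyperedges il r (generators order)
           (trans (Listₚ.length-map just (units (suc order))) (length-units (suc order)))
    with b , s ← eliminate-shaped (rows L hyperedges) (units-shaped order)
    = _ , run-⨾ x (run-⨾ y (run-⨾ run-perform run-perform)) ,
      trans (verdict-value s)
        (sym (trans (solutions-eliminate (rows L hyperedges))
                    (spanSum-shaped s (zeros _) (last-zeros order))))

-- Polynomial bounds

Polynomial : (ℕ → ℕ → ℕ) → Set
Polynomial f = ∃[ C ] ∃[ d ] ∀ n m → f n m ≤ C * suc (n + m) ^ d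

constant : ∀ c → Polynomial (λ _ _ → c)
constant c = c , 0 , λ n m → ≤-reflexive (sym (*-identityʳ c))

linear : ∀ {f} → (∀ n m → f n m ≤ n + m) → Polynomial f
linear {f} f≤ = 1 , 1 , λ n m → begin
  f n m                 ≤⟨ f≤ n m ⟩
  n + m                 ≤⟨ n≤1+n (n + m) ⟩
  suc (n + m)           ≡⟨ *-identityʳ _ ⟨
  suc (n + m) * 1       ≡⟨ *-identityˡ _ ⟨
  1 * (suc (n + m) * 1) ∎
  where open ≤-Reasoning

infixl 6 _+ᵖ_
infixl 7 _*ᵖ_

-- As the base is positive, the exponent `d + e` dominates both and stands in for their maximum.
_+ᵖ_ : ∀ {f g} → Polynomial f → Polynomial g → Polynomial (λ n m → f n m + g n m)
_+ᵖ_ {f} {g} (C , d , p) (D , e , q) = C + D , d + e , λ n m → begin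
  f n m + g n m                                 ≤⟨ +-mono-≤ (p n m) (q n m) ⟩
  C * suc (n + m) ^ d + D * suc (n + m) ^ e     ≤⟨ +-mono-≤
    (*-monoʳ-≤ C (^-monoʳ-≤ (suc (n + m)) (m≤m+n d e)))
    (*-monoʳ-≤ D (^-monoʳ-≤ (suc (n + m)) (m≤n+m e d))) ⟩
  C * suc (n + m) ^ (d + e) + D * suc (n + m) ^ (d + e)
    ≡⟨ *-distribʳ-+ (suc (n + m) ^ (d + e)) C D ⟨
  (C + D) * suc (n + m) ^ (d + e) ∎
  where open ≤-Reasoning

_*ᵖ_ : ∀ {f g} → Polynomial f → Polynomial g → Polynomial (λ n m → f n m * g n m)
_*ᵖ_ {f} {g} (C , d , p) (D , e , q) = C * D , d + e , λ n m → begin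
  f n m * g n m                                 ≤⟨ *-mono-≤ (p n m) (q n m) ⟩
  (C * suc (n + m) ^ d) * (D * suc (n + m) ^ e)
    ≡⟨ *-interchange C (suc (n + m) ^ d) D (suc (n + m) ^ e) ⟩
  (C * D) * (suc (n + m) ^ d * suc (n + m) ^ e)
    ≡⟨ cong (C * D *_) (^-distribˡ-+-* (suc (n + m)) d e) ⟨
  (C * D) * suc (n + m) ^ (d + e) ∎
  where open ≤-Reasoning

loopCost≡ : ∀ c n → loopCost c n ≡ n * suc c + 1
loopCost≡ c zero    = refl
loopCost≡ c (suc n) = cong suc (trans (cong (c +_) (loopCost≡ c n)) (sym (+-assoc c (n * suc c) 1)))

loopᵖ : ∀ {f g} → Polynomial f → Polynomial g → Polynomial (λ n m → loopCost (f n m) (g n m))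
loopᵖ {f} {g} p q with C , d , b ← q *ᵖ (constant 1 +ᵖ p) +ᵖ constant 1 =
  C , d , λ n m → ≤-trans (≤-reflexive (loopCost≡ (f n m) (g n m))) (b n m)

module _ (k : ℕ) where

  private
    N : Polynomial (λ n m → n)
    N = linear m≤m+n

    c : ∀ a → Polynomial (λ _ _ → a)
    c = constant

    sweepᵖ : ∀ {f} → Polynomial f → Polynomial (λ n m → f n m * 2 + 1)
    sweepᵖ p = p *ᵖ c 2 +ᵖ c 1

    rewindᵖ : ∀ {f} → Polynomial f → Polynomial (λ n m → rewindCost (f n m))
    rewindᵖ p = c 1 +ᵖ (sweepᵖ p +ᵖ c 1)

    N′ : Polynomial (λ n m → suc n)
    N′ = c 1 +ᵖ N

    gen-polynomial : Polynomial (λ n m → genCost (suc n))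
    gen-polynomial = (c 1 +ᵖ (sweepᵖ N′ +ᵖ rewindᵖ N′)) +ᵖ
      (c 1 +ᵖ (sweepᵖ N′ +ᵖ (rewindᵖ N′ +ᵖ (rewindᵖ N′ +ᵖ c 1))))

    pass-polynomial : Polynomial (λ n m → passCost (suc n) (suc n))
    pass-polynomial = rewindᵖ (N′ *ᵖ N′) +ᵖ (loopᵖ gen-polynomial N′ +ᵖ sweepᵖ N′)

    equation-polynomial : Polynomial (λ n m → equationCost k n (suc n))
    equation-polynomial = c (suc k) +ᵖ (c 1 +ᵖ (sweepᵖ N +ᵖ (c 1 +ᵖ
      (rewindᵖ N′ +ᵖ (rewindᵖ N +ᵖ pass-polynomial)))))

    -- `q` is the number of equations per hyperedge; it is fixed along with the machine, so the
    -- degree may grow with it.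
    hyperedge-polynomial : ∀ q → Polynomial (λ n m → hyperedgeCost k n (suc n) q)
    hyperedge-polynomial zero    = sweepᵖ N +ᵖ rewindᵖ N
    hyperedge-polynomial (suc q) = equation-polynomial +ᵖ hyperedge-polynomial q

    init-polynomial : Polynomial (λ n m → initCost n)
    init-polynomial = c 1 +ᵖ (sweepᵖ N +ᵖ (c 1 +ᵖ (rewindᵖ N′ +ᵖ (rewindᵖ N′ +ᵖ
      (rewindᵖ N +ᵖ (loopᵖ (sweepᵖ N′ +ᵖ rewindᵖ N′) N′ +ᵖ c 1))))))

  counting-polynomial : ∀ q → Polynomial (countingCost k q)
  counting-polynomial q = init-polynomial +ᵖ (loopᵖ (hyperedge-polynomial q) (linear λ n m → m≤n+m m n) +ᵖ c 2)

affine⇒polynomialTime : ∀ {k} → 2 ≤ k → ∀ (f : SymmetricFunction k) L →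
  (∀ x → SymmetricFunction.fun f x ≡ ind (solves L x)) →
  Polynomial (countingCost k (length L)) →
  PolynomialTime (encodeHypergraph {k}) sizeHypergraph (Z f)
affine⇒polynomialTime 2≤k f L affine (C , d , bound) =
  run⇒polynomialTime (counting L) C d λ H →
    let ts , r , v = run-counting 2≤k L H
    in ts , _ , r , trans v (sym (Z-solutions f L affine H)) ,
       bound (Hypergraph.order H) (length (Hypergraph.hyperedges H))

mainTheorem2 : ∀ (k : ℕ) → 2 ≤ k → (f : SymmetricFunction k) → EASY f →
    PolynomialTime (encodeHypergraph {k}) sizeHypergraph (Z f)
mainTheorem2 k 2≤k f easy with L , affine ← easy⇒affine easy =
  affine⇒polynomialTime 2≤k f L affine (counting-polynomial k (length L))
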